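{- Let $\mathtt{P}$ and $\mathtt{Q}$ be finite $\pi$-calculus processes and $\bar n$ the free names of $\mathtt{P}$ and $\mathtt{Q}$. Then $\forall\bar n.\,\mathrm{lbisim}\,[\![\mathtt{P}]\!]\,[\![\mathtt{Q}]\!]$ is provable in $FO\lambda^{\Delta\nabla}$ if and only if $\forall\bar n.\,\mathrm{ebisim}\,[\![\mathtt{P}]\!]\,[\![\mathtt{Q}]\!]$ is provable in $FO\lambda^{\Delta\nabla}$ (both with respect to the definition $\mathbf{D}_\pi$ together with the $\mathrm{lbisim}$ and $\mathrm{ebisim}$ clauses, and with no further assumptions).
   Context: $FO\lambda^{\Delta\nabla}$ (Miller–Tiu): intuitionistic sequent calculus over simply typed $\lambda$-terms with $\top,\bot,\land,\lor,\supset,\forall,\exists$ and $\nabla$ (introduced on both sides via fresh locally scoped variables), raised eigenvariables, and stratified definitions with defR (unfolding) and defL (case analysis over complete sets of unifiers with clause heads); equality $x=x\triangleq\top$. Encoding of finite $\pi$-calculus processes (names as variables of type $n$, no constants): $[\![\cdot]\!]$ maps $0,+,|,\tau.$ to constants, $[x=y]\mathtt{P}\mapsto\mathrm{match}\,x\,y[\![\mathtt{P}]\!]$, $\bar xy.\mathtt{P}\mapsto\mathrm{out}\,x\,y[\![\mathtt{P}]\!]$, $x(y).\mathtt{P}\mapsto\mathrm{in}\,x(\lambda y.[\![\mathtt{P}]\!])$, $(x)\mathtt{P}\mapsto\nu(\lambda x.[\![\mathtt{P}]\!])$. $\mathbf{D}_\pi$ defines $\mathrm{one}:p\to a\to p\to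 o$, $\mathrm{onep}:p\to(n\to a)\to(n\to p)\to o$ (actions $\tau:a$, $\downarrow,\uparrow:n\to n\to a$) by: $\mathrm{one}(\tau P)\tau P\triangleq\top$; $\mathrm{onep}(\mathrm{in}XM)(\downarrow X)M\triangleq\top$; $\mathrm{one}(\mathrm{out}\,x\,y\,P)(\uparrow xy)P\triangleq\top$; $\mathrm{one}(\mathrm{match}\,x\,x\,P)AQ\triangleq\mathrm{one}PAQ$ (also onep); $\mathrm{one}(P+Q)AR\triangleq\mathrm{one}PAR$, $\triangleq\mathrm{one}QAR$ (also onep); $\mathrm{one}(P|Q)A(P'|Q)\triangleq\mathrm{one}PAP'$; $\mathrm{one}(P|Q)A(P|Q')\triangleq\mathrm{one}QAQ'$; $\mathrm{onep}(P|Q)A(\lambda n.(Mn|Q))\triangleq\mathrm{onep}PAM$; $\mathrm{onep}(P|Q)A(\lambda n.(P|Nn))\triangleq\mathrm{onep}QAN$; $\mathrm{one}(\nu\lambda n.Pn)A(\nu\lambda n.Qn)\triangleq\nabla n.\mathrm{one}(Pn)A(Qn)$; $\mathrm{onep}(\nu\lambda n.Pn)A(\lambda m.\nu\lambda n.P'nm)\triangleq\nabla n.\mathrm{onep}(Pn)A(P'n)$; $\mathrm{onep}(\nu\lambda n.Mn)(\uparrow X)M'\triangleq\nabla n.\mathrm{one}(Mn)(\uparrow Xn)(M'n)$; $\mathrm{one}(P|Q)\tau(\nu\lambda n.(Mn|Nn))\triangleq\exists X.\mathrm{onep}P(\downarrow X)M\land\mathrm{onep}Q(\uparrow X)N$ and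 with $\uparrow,\downarrow$ swapped; $\mathrm{one}(P|Q)\tau(MY|Q')\triangleq\exists X.\mathrm{onep}P(\downarrow X)M\land\mathrm{one}Q(\uparrow XY)Q'$; $\mathrm{one}(P|Q)\tau(P'|NY)\triangleq\exists X.\mathrm{one}P(\uparrow XY)P'\land\mathrm{onep}Q(\downarrow X)N$. $\mathrm{lbisim}PQ\triangleq$ conjunction of $\forall A\forall P'[\mathrm{one}PAP'\supset\exists Q'.\mathrm{one}QAQ'\land\mathrm{lbisim}P'Q']$, $\forall X\forall P'[\mathrm{onep}P(\downarrow X)P'\supset\exists Q'.\mathrm{onep}Q(\downarrow X)Q'\land\forall w.\mathrm{lbisim}(P'w)(Q'w)]$, $\forall X\forall P'[\mathrm{onep}P(\uparrow X)P'\supset\exists Q'.\mathrm{onep}Q(\uparrow X)Q'\land\nabla w.\mathrm{lbisim}(P'w)(Q'w)]$, and the three symmetric conjuncts with $P,Q$ swapped. $\mathrm{ebisim}$ is defined by the same clause with $\mathrm{ebisim}$ in place of $\mathrm{lbisim}$, except that the two input conjuncts are $\forall X\forall P'[\mathrm{onep}P(\downarrow X)P'\supset\forall w\exists Q'.\mathrm{onep}Q(\downarrow X)Q'\land\mathrm{ebisim}(P'w)(Q'w)]$ and its symmetric version. -}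

module Defs where

open import Data.Nat using (ℕ; zero; suc)
open import Data.Fin using (Fin; zero; suc)
open import Data.Product using (Σ)
open import Data.Sum using (_⊎_)
open import Data.List using (List; []; _∷_; map)
open import Data.List.Relation.Binary.Permutation.Propositional using (_↭_)
open import Relation.Binary.PropositionalEquality using (_≡_)

-- Simple types (base types: names n, actions a, processes p).
-- Formulas (type o) are a separate syntactic category below.

infixr 30 _⇒_
data Ty : Set where
  tn ta tp : Ty
  _⇒_ : Ty → Ty → Ty

infixl 25 _,_
data Ctx : Set where
  ε   : Ctx
  _,_ : Ctx → Ty → Ctx

infixl 24 _++_
_++_ : Ctx → Ctx → Ctx
Γ ++ ε       = Γ
Γ ++ (Δ , τ) = (Γ ++ Δ) , τ

infix 20 _∋_
data _∋_ : Ctx → Ty → Set where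
  here  : ∀ {Γ τ} → Γ , τ ∋ τ
  there : ∀ {Γ τ α} → Γ ∋ τ → Γ , α ∋ τ

variable
  Γ Δ Θ Θ' σ : Ctx
  τ α : Ty

data Const : Ty → Set where
  nilC        : Const tp
  plusC parC  : Const (tp ⇒ tp ⇒ tp)
  tauC        : Const (tp ⇒ tp)
  matchC outC : Const (tn ⇒ tn ⇒ tp ⇒ tp)
  inC         : Const (tn ⇒ (tn ⇒ tp) ⇒ tp)
  nuC         : Const ((tn ⇒ tp) ⇒ tp)
  tauA        : Const ta
  dnC upC     : Const (tn ⇒ tn ⇒ ta)

data Tm (Γ : Ctx) : Ty → Set where
  var : Γ ∋ τ → Tm Γ τ
  con : Const τ → Tm Γ τ
  lam : Tm (Γ , α) τ → Tm Γ (α ⇒ τ)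
  app : Tm Γ (α ⇒ τ) → Tm Γ α → Tm Γ τ

Ren : Ctx → Ctx → Set
Ren Γ Δ = ∀ {τ} → Γ ∋ τ → Δ ∋ τ

Sub : Ctx → Ctx → Set
Sub Γ Δ = ∀ {τ} → Γ ∋ τ → Tm Δ τ

liftR : Ren Γ Δ → Ren (Γ , α) (Δ , α)
liftR ρ here      = here
liftR ρ (there x) = there (ρ x)

ren : Ren Γ Δ → Tm Γ τ → Tm Δ τ
ren ρ (var x)   = var (ρ x)
ren ρ (con c)   = con c
ren ρ (lam t)   = lam (ren (liftR ρ) t)
ren ρ (app t u) = app (ren ρ t) (ren ρ u)

liftS : Sub Γ Δ → Sub (Γ , α) (Δ , α)
liftS s here      = var here
liftS s (there x) = ren there (s x)

sub : Sub Γ Δ → Tm Γ τ → Tm Δ τ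
sub s (var x)   = s x
sub s (con c)   = con c
sub s (lam t)   = lam (sub (liftS s) t)
sub s (app t u) = app (sub s t) (sub s u)

sub0 : Tm Γ α → Sub (Γ , α) Γ
sub0 u here      = u
sub0 u (there x) = var x

liftR* : (σ : Ctx) → Ren Γ Δ → Ren (Γ ++ σ) (Δ ++ σ)
liftR* ε       ρ = ρ
liftR* (σ , _) ρ = liftR (liftR* σ ρ)

liftS* : (σ : Ctx) → Sub Γ Δ → Sub (Γ ++ σ) (Δ ++ σ)
liftS* ε       s = s
liftS* (σ , _) s = liftS (liftS* σ s)

inL : Ren Γ (Γ ++ Δ)
inL {Δ = ε}     x = x
inL {Δ = Δ , _} x = there (inL {Δ = Δ} x)

inR : Ren Δ (Γ ++ Δ)
inR here      = here
inR (there x) = there (inR x)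

infix 15 _≈_
data _≈_ {Γ : Ctx} : {τ : Ty} → Tm Γ τ → Tm Γ τ → Set where
  β     : (t : Tm (Γ , α) τ) (u : Tm Γ α) → app (lam t) u ≈ sub (sub0 u) t
  η     : (t : Tm Γ (α ⇒ τ)) → t ≈ lam (app (ren there t) (var here))
  ≈refl : {t : Tm Γ τ} → t ≈ t
  ≈sym  : {t u : Tm Γ τ} → t ≈ u → u ≈ t
  ≈trans : {t u v : Tm Γ τ} → t ≈ u → u ≈ v → t ≈ v
  lam≈  : {t u : Tm (Γ , α) τ} → t ≈ u → lam t ≈ lam u
  app≈  : {t t' : Tm Γ (α ⇒ τ)} {u u' : Tm Γ α} → t ≈ t' → u ≈ u' → app t u ≈ app t' u'

raise : Ctx → Ty → Ty
raise ε       τ = τ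
raise (σ , α) τ = raise σ (α ⇒ τ)

raise* : Ctx → Ctx → Ctx
raise* σ ε       = ε
raise* σ (Δ , τ) = raise* σ Δ , raise σ τ

raiseVar : Δ ∋ τ → raise* σ Δ ∋ raise σ τ
raiseVar here      = here
raiseVar (there x) = there (raiseVar x)

appAll : (σ : Ctx) → Tm Γ (raise σ τ) → Tm (Γ ++ σ) τ
appAll ε       t = t
appAll (σ , α) t = app (ren there (appAll σ t)) (var here)

data Atom (Γ : Ctx) : Set where
  one    : Tm Γ tp → Tm Γ ta → Tm Γ tp → Atom Γ
  onep   : Tm Γ tp → Tm Γ (tn ⇒ ta) → Tm Γ (tn ⇒ tp) → Atom Γ
  lbisim : Tm Γ tp → Tm Γ tp → Atom Γ
  ebisim : Tm Γ tp → Tm Γ tp → Atom Γ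
  eq     : (τ : Ty) → Tm Γ τ → Tm Γ τ → Atom Γ

infixr 12 _⊃ᶠ_
infixr 13 _∨ᶠ_
infixr 14 _∧ᶠ_
data Fm (Γ : Ctx) : Set where
  atom : Atom Γ → Fm Γ
  ⊤ᶠ ⊥ᶠ : Fm Γ
  _∧ᶠ_ _∨ᶠ_ _⊃ᶠ_ : Fm Γ → Fm Γ → Fm Γ
  ∀ᶠ ∃ᶠ ∇ᶠ : (τ : Ty) → Fm (Γ , τ) → Fm Γ

subA : Sub Γ Δ → Atom Γ → Atom Δ
subA s (one P A Q)    = one (sub s P) (sub s A) (sub s Q)
subA s (onep P A Q)   = onep (sub s P) (sub s A) (sub s Q)
subA s (lbisim P Q)   = lbisim (sub s P) (sub s Q)
subA s (ebisim P Q)   = ebisim (sub s P) (sub s Q)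
subA s (eq τ t u)     = eq τ (sub s t) (sub s u)

subF : Sub Γ Δ → Fm Γ → Fm Δ
subF s (atom A)  = atom (subA s A)
subF s ⊤ᶠ        = ⊤ᶠ
subF s ⊥ᶠ        = ⊥ᶠ
subF s (A ∧ᶠ B)  = subF s A ∧ᶠ subF s B
subF s (A ∨ᶠ B)  = subF s A ∨ᶠ subF s B
subF s (A ⊃ᶠ B)  = subF s A ⊃ᶠ subF s B
subF s (∀ᶠ τ B)  = ∀ᶠ τ (subF (liftS s) B)
subF s (∃ᶠ τ B)  = ∃ᶠ τ (subF (liftS s) B)
subF s (∇ᶠ τ B)  = ∇ᶠ τ (subF (liftS s) B)

renS : Ren Γ Δ → Sub Γ Δ
renS ρ x = var (ρ x)

infix 15 _≈A_ _≈F_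
data _≈A_ {Γ : Ctx} : Atom Γ → Atom Γ → Set where
  one≈    : ∀ {P P' A A' Q Q'} → P ≈ P' → A ≈ A' → Q ≈ Q' → one P A Q ≈A one P' A' Q'
  onep≈   : ∀ {P P' A A' Q Q'} → P ≈ P' → A ≈ A' → Q ≈ Q' → onep P A Q ≈A onep P' A' Q'
  lbisim≈ : ∀ {P P' Q Q'} → P ≈ P' → Q ≈ Q' → lbisim P Q ≈A lbisim P' Q'
  ebisim≈ : ∀ {P P' Q Q'} → P ≈ P' → Q ≈ Q' → ebisim P Q ≈A ebisim P' Q'
  eq≈     : ∀ {t t' u u'} → t ≈ t' → u ≈ u' → eq τ t u ≈A eq τ t' u'

data _≈F_ {Γ : Ctx} : Fm Γ → Fm Γ → Set where
  atom≈ : ∀ {A B} → A ≈A B → atom A ≈F atom B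
  ⊤≈ : ⊤ᶠ ≈F ⊤ᶠ
  ⊥≈ : ⊥ᶠ ≈F ⊥ᶠ
  ∧≈ : ∀ {A A' B B'} → A ≈F A' → B ≈F B' → (A ∧ᶠ B) ≈F (A' ∧ᶠ B')
  ∨≈ : ∀ {A A' B B'} → A ≈F A' → B ≈F B' → (A ∨ᶠ B) ≈F (A' ∨ᶠ B')
  ⊃≈ : ∀ {A A' B B'} → A ≈F A' → B ≈F B' → (A ⊃ᶠ B) ≈F (A' ⊃ᶠ B')
  ∀≈ : ∀ {B B'} → B ≈F B' → ∀ᶠ τ B ≈F ∀ᶠ τ B'
  ∃≈ : ∀ {B B'} → B ≈F B' → ∃ᶠ τ B ≈F ∃ᶠ τ B'
  ∇≈ : ∀ {B B'} → B ≈F B' → ∇ᶠ τ B ≈F ∇ᶠ τ B'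

record Clause : Set where
  constructor clause
  field
    ctx  : Ctx
    head : Atom ctx
    body : Fm ctx
open Clause public

v0 : Tm (Γ , α) α
v0 = var here
v1 : ∀ {β} → Tm (Γ , α , β) α
v1 = var (there here)
v2 : ∀ {β γ} → Tm (Γ , α , β , γ) α
v2 = var (there (there here))
v3 : ∀ {β γ δ} → Tm (Γ , α , β , γ , δ) α
v3 = var (there (there (there here)))
v4 : ∀ {β γ δ ζ} → Tm (Γ , α , β , γ , δ , ζ) α
v4 = var (there (there (there (there here))))
v5 : ∀ {β γ δ ζ ξ} → Tm (Γ , α , β , γ , δ , ζ , ξ) α
v5 = var (there (there (there (there (there here)))))

↑ : Tm Γ τ → Tm (Γ , α) τ
↑ = ren there

infixl 40 _·_
_·_ : Tm Γ (α ⇒ τ) → Tm Γ α → Tm Γ τ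
_·_ = app

τ· : Tm Γ tp → Tm Γ tp
τ· P = con tauC · P
_⊕_ _∣_ : Tm Γ tp → Tm Γ tp → Tm Γ tp
P ⊕ Q = con plusC · P · Q
P ∣ Q = con parC · P · Q
mtch outp : Tm Γ tn → Tm Γ tn → Tm Γ tp → Tm Γ tp
mtch x y P = con matchC · x · y · P
outp x y P = con outC · x · y · P
inp : Tm Γ tn → Tm Γ (tn ⇒ tp) → Tm Γ tp
inp x M = con inC · x · M
ν : Tm Γ (tn ⇒ tp) → Tm Γ tp
ν M = con nuC · M
↓ ↑ₐ : Tm Γ tn → Tm Γ (tn ⇒ ta)
↓ x = con dnC · x
↑ₐ x = con upC · x

Rel : Set
Rel = ∀ {Γ} → Tm Γ tp → Tm Γ tp → Atom Γ

freeC : Rel → Tm Γ tp → Tm Γ tp → Fm Γ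
freeC R P Q =
  ∀ᶠ ta (∀ᶠ tp (atom (one (↑ (↑ P)) v1 v0) ⊃ᶠ
    ∃ᶠ tp (atom (one (↑ (↑ (↑ Q))) v2 v0) ∧ᶠ atom (R v1 v0))))

lInC : Rel → Tm Γ tp → Tm Γ tp → Fm Γ
lInC R P Q =
  ∀ᶠ tn (∀ᶠ (tn ⇒ tp) (atom (onep (↑ (↑ P)) (↓ v1) v0) ⊃ᶠ
    ∃ᶠ (tn ⇒ tp) (atom (onep (↑ (↑ (↑ Q))) (↓ v2) v0) ∧ᶠ
      ∀ᶠ tn (atom (R (v2 · v0) (v1 · v0))))))

eInC : Rel → Tm Γ tp → Tm Γ tp → Fm Γ
eInC R P Q =
  ∀ᶠ tn (∀ᶠ (tn ⇒ tp) (atom (onep (↑ (↑ P)) (↓ v1) v0) ⊃ᶠ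
    ∀ᶠ tn (∃ᶠ (tn ⇒ tp) (atom (onep (↑ (↑ (↑ (↑ Q)))) (↓ v3) v0) ∧ᶠ
      atom (R (v2 · v1) (v0 · v1))))))

outConj : Rel → Tm Γ tp → Tm Γ tp → Fm Γ
outConj R P Q =
  ∀ᶠ tn (∀ᶠ (tn ⇒ tp) (atom (onep (↑ (↑ P)) (↑ₐ v1) v0) ⊃ᶠ
    ∃ᶠ (tn ⇒ tp) (atom (onep (↑ (↑ (↑ Q))) (↑ₐ v2) v0) ∧ᶠ
      ∇ᶠ tn (atom (R (v2 · v0) (v1 · v0))))))

lbisimBody : Tm Γ tp → Tm Γ tp → Fm Γ
lbisimBody P Q =
  (freeC lbisim P Q ∧ᶠ lInC lbisim P Q ∧ᶠ outConj lbisim P Q) ∧ᶠ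
  (freeC lbisim Q P ∧ᶠ lInC lbisim Q P ∧ᶠ outConj lbisim Q P)

ebisimBody : Tm Γ tp → Tm Γ tp → Fm Γ
ebisimBody P Q =
  (freeC ebisim P Q ∧ᶠ eInC ebisim P Q ∧ᶠ outConj ebisim P Q) ∧ᶠ
  (freeC ebisim Q P ∧ᶠ eInC ebisim Q P ∧ᶠ outConj ebisim Q P)

P1 = tp ; N1 = tn ; A1 = ta
NP = tn ⇒ tp ; NA = tn ⇒ ta

data Dπ : Clause → Set where
  c-tau   : Dπ (clause (ε , tp) (one (τ· v0) (con tauA) v0) ⊤ᶠ)
  c-in    : Dπ (clause (ε , tn , NP) (onep (inp v1 v0) (↓ v1) v0) ⊤ᶠ)
  c-out   : Dπ (clause (ε , tn , tn , tp) (one (outp v2 v1 v0) (con upC · v2 · v1) v0) ⊤ᶠ)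
  c-match  : Dπ (clause (ε , tn , tp , ta , tp) (one (mtch v3 v3 v2) v1 v0) (atom (one v2 v1 v0)))
  c-matchp : Dπ (clause (ε , tn , tp , NA , NP) (onep (mtch v3 v3 v2) v1 v0) (atom (onep v2 v1 v0)))
  c-sumL  : Dπ (clause (ε , tp , tp , ta , tp) (one (v3 ⊕ v2) v1 v0) (atom (one v3 v1 v0)))
  c-sumR  : Dπ (clause (ε , tp , tp , ta , tp) (one (v3 ⊕ v2) v1 v0) (atom (one v2 v1 v0)))
  c-sumLp : Dπ (clause (ε , tp , tp , NA , NP) (onep (v3 ⊕ v2) v1 v0) (atom (onep v3 v1 v0)))
  c-sumRp : Dπ (clause (ε , tp , tp , NA , NP) (onep (v3 ⊕ v2) v1 v0) (atom (onep v2 v1 v0)))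
  c-parL  : Dπ (clause (ε , tp , tp , ta , tp) (one (v3 ∣ v2) v1 (v0 ∣ v2)) (atom (one v3 v1 v0)))
  c-parR  : Dπ (clause (ε , tp , tp , ta , tp) (one (v3 ∣ v2) v1 (v3 ∣ v0)) (atom (one v2 v1 v0)))
  c-parLp : Dπ (clause (ε , tp , tp , NA , NP)
                 (onep (v3 ∣ v2) v1 (lam ((↑ v0 · v0) ∣ ↑ v2))) (atom (onep v3 v1 v0)))
  c-parRp : Dπ (clause (ε , tp , tp , NA , NP)
                 (onep (v3 ∣ v2) v1 (lam (↑ v3 ∣ (↑ v0 · v0)))) (atom (onep v2 v1 v0)))
  c-res   : Dπ (clause (ε , NP , ta , NP)
                 (one (ν (lam (↑ v2 · v0))) v1 (ν (lam (↑ v0 · v0))))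
                 (∇ᶠ tn (atom (one (↑ v2 · v0) (↑ v1) (↑ v0 · v0)))))
  c-resp  : Dπ (clause (ε , NP , NA , tn ⇒ tn ⇒ tp)
                 (onep (ν (lam (↑ v2 · v0))) v1 (lam (ν (lam (↑ (↑ v0) · v0 · v1)))))
                 (∇ᶠ tn (atom (onep (↑ v2 · v0) (↑ v1) (↑ v0 · v0)))))
  c-open  : Dπ (clause (ε , NP , tn , NP)
                 (onep (ν (lam (↑ v2 · v0))) (↑ₐ v1) v0)
                 (∇ᶠ tn (atom (one (↑ v2 · v0) (↑ₐ (↑ v1) · v0) (↑ v0 · v0)))))
  c-close₁ : Dπ (clause (ε , tp , tp , NP , NP)
                 (one (v3 ∣ v2) (con tauA) (ν (lam ((↑ v1 · v0) ∣ (↑ v0 · v0)))))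
                 (∃ᶠ tn (atom (onep v4 (↓ v0) v2) ∧ᶠ atom (onep v3 (↑ₐ v0) v1))))
  c-close₂ : Dπ (clause (ε , tp , tp , NP , NP)
                 (one (v3 ∣ v2) (con tauA) (ν (lam ((↑ v1 · v0) ∣ (↑ v0 · v0)))))
                 (∃ᶠ tn (atom (onep v4 (↑ₐ v0) v2) ∧ᶠ atom (onep v3 (↓ v0) v1))))
  c-com₁  : Dπ (clause (ε , tp , tp , NP , tn , tp)
                 (one (v4 ∣ v3) (con tauA) ((v2 · v1) ∣ v0))
                 (∃ᶠ tn (atom (onep v5 (↓ v0) v3) ∧ᶠ atom (one v4 (con upC · v0 · v2) v1))))
  c-com₂  : Dπ (clause (ε , tp , tp , tp , NP , tn)
                 (one (v4 ∣ v3) (con tauA) (v2 ∣ (v1 · v0)))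
                 (∃ᶠ tn (atom (one v5 (con upC · v0 · v1) v3) ∧ᶠ atom (onep v4 (↓ v0) v2))))
  c-lbisim : Dπ (clause (ε , tp , tp) (lbisim v1 v0) (lbisimBody v1 v0))
  c-ebisim : Dπ (clause (ε , tp , tp) (ebisim v1 v0) (ebisimBody v1 v0))
  c-eq     : (τ : Ty) → Dπ (clause (ε , τ) (eq τ v0 v0) ⊤ᶠ)

-- Generic judgments  σ ▹ B  over the global eigenvariable signature Θ

infix 11 _▹_
record GJ (Θ : Ctx) : Set where
  constructor _▹_
  field
    loc : Ctx
    fm  : Fm (Θ ++ loc)
open GJ public

subGJ : Sub Θ Θ' → GJ Θ → GJ Θ'
subGJ s (σ ▹ B) = σ ▹ subF (liftS* σ s) B

subCx : Sub Θ Θ' → List (GJ Θ) → List (GJ Θ')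
subCx s = map (subGJ s)

wkS : Sub Θ (Θ , α)
wkS x = var (there x)

-- [h σ / x] where h is the new (raised) eigenvariable, last in Θ , raise σ τ
raiseSub : (σ : Ctx) → Sub ((Θ ++ σ) , τ) ((Θ , raise σ τ) ++ σ)
raiseSub σ here      = appAll σ (var here)
raiseSub σ (there x) = var (liftR* σ there x)

-- Raising a clause over σ: clause variables x̄ : Δ become h̄ : raise* σ Δ,
-- appended to the eigenvariables, and x ↦ h σ.
clauseSub : (σ : Ctx) → Sub Δ ((Θ ++ raise* σ Δ) ++ σ)
clauseSub {Θ = Θ} σ x = appAll σ (var (inR {Γ = Θ} (raiseVar x)))

-- Unifiers and complete sets of unifiers of two atoms A, B over Ξ ++ σ,
-- where Ξ are the (global, instantiable) variables and σ the local ones.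
record Unifier (Ξ σ : Ctx) (A B : Atom (Ξ ++ σ)) : Set where
  field
    target  : Ctx
    θ       : Sub Ξ target
    unifies : subA (liftS* σ θ) A ≈A subA (liftS* σ θ) B
open Unifier public

record CSU (Ξ σ : Ctx) (A B : Atom (Ξ ++ σ)) : Set₁ where
  field
    Idx      : Set
    member   : Idx → Unifier Ξ σ A B
    complete : (u : Unifier Ξ σ A B) →
               Σ Idx λ i → Σ (Sub (target (member i)) (target u)) λ δ →
               ∀ {τ} (x : Ξ ∋ τ) → θ u x ≈ sub δ (θ (member i) x)
open CSU public

-- the unification problem of defL for atom A (local signature σ) and clause c
Ξ[_,_,_] : Ctx → Ctx → Clause → Ctx
Ξ[ Θ , σ , c ] = Θ ++ raise* σ (ctx c)

liftedAtom : (σ : Ctx) (c : Clause) → Atom (Θ ++ σ) → Atom (Ξ[ Θ , σ , c ] ++ σ)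
liftedAtom σ c A = subA (renS (liftR* σ inL)) A

raisedHead : (σ : Ctx) (c : Clause) → Atom (Ξ[ Θ , σ , c ] ++ σ)
raisedHead {Θ = Θ} σ c = subA (clauseSub {Θ = Θ} σ) (head c)

raisedBody : (σ : Ctx) (c : Clause) → Fm (Ξ[ Θ , σ , c ] ++ σ)
raisedBody {Θ = Θ} σ c = subF (clauseSub {Θ = Θ} σ) (body c)

restr : (σ : Ctx) (c : Clause) → Sub Ξ[ Θ , σ , c ] Θ' → Sub Θ Θ'
restr σ c θ x = θ (inL x)

-- The sequent calculus FOλ^{Δ∇} with respect to the definition Dπ.
-- Sequent  Θ ⨾ Γ ⊢ C : Θ eigenvariables, Γ multiset (list + exchange) of
-- generic judgments, C a generic judgment.

infix 5 _⨾_⊢_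
data _⨾_⊢_ (Θ : Ctx) : List (GJ Θ) → GJ Θ → Set₁ where
  init : ∀ {Γ σ} {A B : Fm (Θ ++ σ)} → A ≈F B → Θ ⨾ (σ ▹ A) ∷ Γ ⊢ σ ▹ B
  cut  : ∀ {Γ D C} → Θ ⨾ Γ ⊢ D → Θ ⨾ D ∷ Γ ⊢ C → Θ ⨾ Γ ⊢ C
  exch : ∀ {Γ Γ' C} → Γ ↭ Γ' → Θ ⨾ Γ ⊢ C → Θ ⨾ Γ' ⊢ C
  wL   : ∀ {Γ D C} → Θ ⨾ Γ ⊢ C → Θ ⨾ D ∷ Γ ⊢ C
  cL   : ∀ {Γ D C} → Θ ⨾ D ∷ D ∷ Γ ⊢ C → Θ ⨾ D ∷ Γ ⊢ C
  ⊥L   : ∀ {Γ σ C} → Θ ⨾ (σ ▹ ⊥ᶠ) ∷ Γ ⊢ C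
  ⊤R   : ∀ {Γ σ} → Θ ⨾ Γ ⊢ σ ▹ ⊤ᶠ
  ∧L₁  : ∀ {Γ σ A B C} → Θ ⨾ (σ ▹ A) ∷ Γ ⊢ C → Θ ⨾ (σ ▹ A ∧ᶠ B) ∷ Γ ⊢ C
  ∧L₂  : ∀ {Γ σ A B C} → Θ ⨾ (σ ▹ B) ∷ Γ ⊢ C → Θ ⨾ (σ ▹ A ∧ᶠ B) ∷ Γ ⊢ C
  ∧R   : ∀ {Γ σ A B} → Θ ⨾ Γ ⊢ σ ▹ A → Θ ⨾ Γ ⊢ σ ▹ B → Θ ⨾ Γ ⊢ σ ▹ A ∧ᶠ B
  ∨L   : ∀ {Γ σ A B C} → Θ ⨾ (σ ▹ A) ∷ Γ ⊢ C → Θ ⨾ (σ ▹ B) ∷ Γ ⊢ C →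
         Θ ⨾ (σ ▹ A ∨ᶠ B) ∷ Γ ⊢ C
  ∨R₁  : ∀ {Γ σ A B} → Θ ⨾ Γ ⊢ σ ▹ A → Θ ⨾ Γ ⊢ σ ▹ A ∨ᶠ B
  ∨R₂  : ∀ {Γ σ A B} → Θ ⨾ Γ ⊢ σ ▹ B → Θ ⨾ Γ ⊢ σ ▹ A ∨ᶠ B
  ⊃L   : ∀ {Γ σ A B C} → Θ ⨾ Γ ⊢ σ ▹ A → Θ ⨾ (σ ▹ B) ∷ Γ ⊢ C →
         Θ ⨾ (σ ▹ A ⊃ᶠ B) ∷ Γ ⊢ C
  ⊃R   : ∀ {Γ σ A B} → Θ ⨾ (σ ▹ A) ∷ Γ ⊢ σ ▹ B → Θ ⨾ Γ ⊢ σ ▹ A ⊃ᶠ B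
  ∀L   : ∀ {Γ σ τ B C} (t : Tm (Θ ++ σ) τ) →
         Θ ⨾ (σ ▹ subF (sub0 t) B) ∷ Γ ⊢ C → Θ ⨾ (σ ▹ ∀ᶠ τ B) ∷ Γ ⊢ C
  ∀R   : ∀ {Γ σ τ B} →
         (Θ , raise σ τ) ⨾ subCx wkS Γ ⊢ σ ▹ subF (raiseSub σ) B →
         Θ ⨾ Γ ⊢ σ ▹ ∀ᶠ τ B
  ∃L   : ∀ {Γ σ τ B C} →
         (Θ , raise σ τ) ⨾ (σ ▹ subF (raiseSub σ) B) ∷ subCx wkS Γ ⊢ subGJ wkS C →
         Θ ⨾ (σ ▹ ∃ᶠ τ B) ∷ Γ ⊢ C
  ∃R   : ∀ {Γ σ τ B} (t : Tm (Θ ++ σ) τ) →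
         Θ ⨾ Γ ⊢ σ ▹ subF (sub0 t) B → Θ ⨾ Γ ⊢ σ ▹ ∃ᶠ τ B
  ∇L   : ∀ {Γ σ τ B C} → Θ ⨾ ((σ , τ) ▹ B) ∷ Γ ⊢ C → Θ ⨾ (σ ▹ ∇ᶠ τ B) ∷ Γ ⊢ C
  ∇R   : ∀ {Γ σ τ B} → Θ ⨾ Γ ⊢ (σ , τ) ▹ B → Θ ⨾ Γ ⊢ σ ▹ ∇ᶠ τ B
  defR : ∀ {Γ σ A} (c : Clause) → Dπ c → (θ : Sub (ctx c) (Θ ++ σ)) →
         A ≈A subA θ (head c) → Θ ⨾ Γ ⊢ σ ▹ subF θ (body c) →
         Θ ⨾ Γ ⊢ σ ▹ atom A
  defL : ∀ {Γ σ A C}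
         (U : (c : Clause) → Dπ c →
              CSU Ξ[ Θ , σ , c ] σ (liftedAtom σ c A) (raisedHead σ c)) →
         ((c : Clause) (d : Dπ c) (i : Idx (U c d)) →
            let u = member (U c d) i in
            target u ⨾ (σ ▹ subF (liftS* σ (θ u)) (raisedBody σ c))
                        ∷ subCx (restr σ c (θ u)) Γ
                      ⊢ subGJ (restr σ c (θ u)) C) →
         Θ ⨾ (σ ▹ atom A) ∷ Γ ⊢ C

Provable : Fm ε → Set₁
Provable B = ε ⨾ [] ⊢ ε ▹ B

-- Finite π-calculus processes with k free-name slots (de Bruijn names).

data Proc (k : ℕ) : Set where
  pnil   : Proc k
  psum   : Proc k → Proc k → Proc k
  ppar   : Proc k → Proc k → Proc k
  ptau   : Proc k → Proc k
  pmatch : Fin k → Fin k → Proc k → Proc k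
  pout   : Fin k → Fin k → Proc k → Proc k
  pin    : Fin k → Proc (suc k) → Proc k          -- x(y). P   (y is name 0)
  pres   : Proc (suc k) → Proc k                  -- (x) P     (x is name 0)

data _freeIn_ {k : ℕ} (i : Fin k) : Proc k → Set where
  sumL   : ∀ {P Q} → i freeIn P → i freeIn psum P Q
  sumR   : ∀ {P Q} → i freeIn Q → i freeIn psum P Q
  parL   : ∀ {P Q} → i freeIn P → i freeIn ppar P Q
  parR   : ∀ {P Q} → i freeIn Q → i freeIn ppar P Q
  tauI   : ∀ {P} → i freeIn P → i freeIn ptau P
  matchX : ∀ {x y P} → i ≡ x → i freeIn pmatch x y P
  matchY : ∀ {x y P} → i ≡ y → i freeIn pmatch x y P
  matchP : ∀ {x y P} → i freeIn P → i freeIn pmatch x y P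
  outX   : ∀ {x y P} → i ≡ x → i freeIn pout x y P
  outY   : ∀ {x y P} → i ≡ y → i freeIn pout x y P
  outP   : ∀ {x y P} → i freeIn P → i freeIn pout x y P
  inX    : ∀ {x P} → i ≡ x → i freeIn pin x P
  inP    : ∀ {x P} → suc i freeIn P → i freeIn pin x P
  resP   : ∀ {P} → suc i freeIn P → i freeIn pres P

nctx : ℕ → Ctx
nctx zero    = ε
nctx (suc k) = nctx k , tn

name : ∀ {k} → Fin k → nctx k ∋ tn
name zero    = here
name (suc i) = there (name i)

⟦_⟧ : ∀ {k} → Proc k → Tm (nctx k) tp
⟦ pnil ⟧         = con nilC
⟦ psum P Q ⟧     = ⟦ P ⟧ ⊕ ⟦ Q ⟧
⟦ ppar P Q ⟧     = ⟦ P ⟧ ∣ ⟦ Q ⟧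
⟦ ptau P ⟧       = τ· ⟦ P ⟧
⟦ pmatch x y P ⟧ = mtch (var (name x)) (var (name y)) ⟦ P ⟧
⟦ pout x y P ⟧   = outp (var (name x)) (var (name y)) ⟦ P ⟧
⟦ pin x P ⟧      = inp (var (name x)) (lam ⟦ P ⟧)
⟦ pres P ⟧       = ν (lam ⟦ P ⟧)

∀names : (k : ℕ) → Fm (nctx k) → Fm ε
∀names zero    B = B
∀names (suc k) B = ∀names k (∀ᶠ tn B)

{-# OPTIONS --safe #-}

-- Since nothing decides equality of names, a proof of ∀w ∃Q'. … must give a Q' uniform in w, and this
-- erases the difference between late and early.  To make this precise, the calculus is interpreted in
-- a Kripke model whose stages are the signatures of eigenvariables and whose transitions between
-- stages are all substitutions; one, onep, lbisim and ebisim are least fixed points of their clauses.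
-- In the model an early answer Q' to a fresh name w cannot mention w, because transitions invent no
-- names; so it serves as a late answer.  Conversely, truth of lbisim or ebisim at process terms yields
-- a derivation: transition hypotheses on process terms are eliminated by a well-founded tree of uses
-- of defL, with the set of all unifiers as complete set, and after that only right rules are needed.

module Submission where

open import Defs
open import Data.Empty using (⊥)
open import Data.Fin using (Fin)
open import Data.List using (List; []; _∷_)
open import Data.List.Relation.Binary.Permutation.Propositional using (↭-sym)
open import Data.List.Relation.Binary.Permutation.Propositional.Properties using (All-resp-↭)
open import Data.List.Relation.Unary.All as All using (All; []; _∷_)
import Data.List.Relation.Unary.All.Properties as All
open import Data.Nat using (ℕ; zero; suc)
open import Data.Product using (Σ; _×_; proj₁; proj₂) renaming (_,_ to infixr 4 _&_)
open import Data.Sum using (_⊎_; inj₁; inj₂)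
open import Data.Unit using (⊤; tt)
open import Function.Bundles using (_⇔_; mk⇔)
open import Relation.Binary.PropositionalEquality
  using (_≡_; refl; sym; trans; cong; cong₂; subst; subst₂)

-- Stages must be related by all substitutions, including those that identify names, because `defL`
-- instantiates eigenvariables by unifiers. Soundness of `defL` is then the factorisation property
-- of whatever complete set the derivation chose. Local variables are never instantiated: a
-- transition is lifted under the local signature, and a term over that signature stands for the
-- value of a raised eigenvariable. Bisimilarity occurs in its own clause under implications, but
-- only transition atoms stand to the left of them. So transitions can be interpreted first, and
-- bisimilarity over them is strictly positive. Taking least fixed points turns the later arguments
-- into structural recursions. Late and early truth are compared at arbitrary terms. The way back to
-- derivations is restricted to process terms, because a hypothesis about a variable of type `tp`
-- could be unfolded forever. Since atoms are read up to βη, every inversion of a clause head rests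
-- on injectivity of constants modulo conversion.

variable
  Ψ : Ctx

-- Substitutions

infixr 19 _∘ₛ_
_∘ₛ_ : Sub Δ Θ → Sub Γ Δ → Sub Γ Θ
(s ∘ₛ u) x = sub s (u x)

infixl 18 _▸_
_▸_ : Sub Γ Δ → Tm Δ τ → Sub (Γ , τ) Δ
(s ▸ t) here      = t
(s ▸ t) (there x) = s x

infix 15 _≗ₛ_ _≈ₛ_
_≗ₛ_ _≈ₛ_ : Sub Γ Δ → Sub Γ Δ → Set
s ≗ₛ u = ∀ {τ} (x : _ ∋ τ) → s x ≡ u x
s ≈ₛ u = ∀ {τ} (x : _ ∋ τ) → s x ≈ u x

≡⇒≈ : {t u : Tm Γ τ} → t ≡ u → t ≈ u
≡⇒≈ refl = ≈refl

-- The composite is a separate argument with a pointwise equation, here and in the laws below: this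
-- form passes under binders without equating substitutions as functions.
ren-ren : (ρ : Ren Δ Θ) (ρ' : Ren Γ Δ) (ρ'' : Ren Γ Θ) →
          (∀ {τ} (x : Γ ∋ τ) → ρ (ρ' x) ≡ ρ'' x) →
          (t : Tm Γ τ) → ren ρ (ren ρ' t) ≡ ren ρ'' t
ren-ren ρ ρ' ρ'' e (var x)   = cong var (e x)
ren-ren ρ ρ' ρ'' e (con c)   = refl
ren-ren ρ ρ' ρ'' e (lam t)   = cong lam (ren-ren (liftR ρ) (liftR ρ') (liftR ρ'')
  (λ { here → refl ; (there x) → cong there (e x) }) t)
ren-ren ρ ρ' ρ'' e (app t u) = cong₂ app (ren-ren ρ ρ' ρ'' e t) (ren-ren ρ ρ' ρ'' e u)

sub-ren : (s : Sub Δ Θ) (ρ : Ren Γ Δ) (u : Sub Γ Θ) →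
          (∀ {τ} (x : Γ ∋ τ) → s (ρ x) ≡ u x) →
          (t : Tm Γ τ) → sub s (ren ρ t) ≡ sub u t
sub-ren s ρ u e (var x)   = e x
sub-ren s ρ u e (con c)   = refl
sub-ren s ρ u e (lam t)   = cong lam (sub-ren (liftS s) (liftR ρ) (liftS u)
  (λ { here → refl ; (there x) → cong (ren there) (e x) }) t)
sub-ren s ρ u e (app t v) = cong₂ app (sub-ren s ρ u e t) (sub-ren s ρ u e v)

ren-sub : (ρ : Ren Δ Θ) (s : Sub Γ Δ) (u : Sub Γ Θ) →
          (∀ {τ} (x : Γ ∋ τ) → ren ρ (s x) ≡ u x) →
          (t : Tm Γ τ) → ren ρ (sub s t) ≡ sub u t
ren-sub ρ s u e (var x)   = e x
ren-sub ρ s u e (con c)   = refl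
ren-sub {Δ} {Θ} ρ s u e (lam {α = α} t)   = cong lam (ren-sub (liftR ρ) (liftS s) (liftS u)
  (λ { here → refl
     ; (there x) → trans (ren-ren (liftR ρ) there (λ y → there (ρ y)) (λ _ → refl) (s x))
         (trans (sym (ren-ren there ρ (λ y → there (ρ y)) (λ _ → refl) (s x)))
                (cong (ren there) (e x))) }) t)
ren-sub ρ s u e (app t v) = cong₂ app (ren-sub ρ s u e t) (ren-sub ρ s u e v)

lift-∘ : (s : Sub Δ Θ) (u : Sub Γ Δ) → liftS {α = α} s ∘ₛ liftS u ≗ₛ liftS (s ∘ₛ u)
lift-∘ s u here      = refl
lift-∘ s u (there x) =
  trans (sub-ren (liftS s) there (λ y → ren there (s y)) (λ _ → refl) (u x))
        (sym (ren-sub there s (λ y → ren there (s y)) (λ _ → refl) (u x)))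

lift-ext : {s u : Sub Γ Δ} → s ≗ₛ u → liftS {α = α} s ≗ₛ liftS u
lift-ext e here      = refl
lift-ext e (there x) = cong (ren there) (e x)

sub-sub : (s : Sub Δ Θ) (u : Sub Γ Δ) (v : Sub Γ Θ) → s ∘ₛ u ≗ₛ v →
          (t : Tm Γ τ) → sub s (sub u t) ≡ sub v t
sub-sub s u v e (var x)    = e x
sub-sub s u v e (con c)    = refl
sub-sub s u v e (lam t)    = cong lam (sub-sub (liftS s) (liftS u) (liftS v)
  (λ x → trans (lift-∘ s u x) (lift-ext {s = s ∘ₛ u} {u = v} e x)) t)
sub-sub s u v e (app t t') = cong₂ app (sub-sub s u v e t) (sub-sub s u v e t')

sub-id : (s : Sub Γ Γ) → s ≗ₛ var → (t : Tm Γ τ) → sub s t ≡ t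
sub-id s e (var x)   = e x
sub-id s e (con c)   = refl
sub-id s e (lam t)   = cong lam (sub-id (liftS s)
  (λ { here → refl ; (there x) → cong (ren there) (e x) }) t)
sub-id s e (app t u) = cong₂ app (sub-id s e t) (sub-id s e u)

ren-as-sub : (ρ : Ren Γ Δ) (t : Tm Γ τ) → ren ρ t ≡ sub (renS ρ) t
ren-as-sub ρ t = trans (cong (ren ρ) (sym (sub-id var (λ _ → refl) t)))
                       (ren-sub ρ var (renS ρ) (λ _ → refl) t)

ren-id : (t : Tm Γ τ) → ren (λ x → x) t ≡ t
ren-id t = trans (ren-as-sub (λ x → x) t) (sub-id var (λ _ → refl) t)

sub-ext : (s u : Sub Γ Δ) → s ≗ₛ u → (t : Tm Γ τ) → sub s t ≡ sub u t
sub-ext s u e t = trans (cong (sub s) (sym (sub-id var (λ _ → refl) t)))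
                        (sub-sub s var u e t)

sub-↑ : (s : Sub (Γ , α) Δ) (t : Tm Γ τ) → sub s (↑ t) ≡ sub (λ x → s (there x)) t
sub-↑ s t = sub-ren s there (λ x → s (there x)) (λ _ → refl) t

sub-lift-↑ : (s : Sub Γ Δ) (t : Tm Γ τ) → sub (liftS {α = α} s) (↑ t) ≡ ↑ (sub s t)
sub-lift-↑ s t = trans (sub-↑ (liftS s) t)
                       (sym (ren-sub there s (λ x → ↑ (s x)) (λ _ → refl) t))

sub0-lift : (s : Sub Γ Δ) (t : Tm Δ α) → sub0 t ∘ₛ liftS s ≗ₛ s ▸ t
sub0-lift s t here      = refl
sub0-lift s t (there x) = trans (sub-↑ (sub0 t) (s x)) (sub-id var (λ _ → refl) (s x))

sub-sub0 : (s : Sub Γ Δ) (t : Tm (Γ , α) τ) (u : Tm Γ α) →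
           sub s (sub (sub0 u) t) ≡ sub (sub0 (sub s u)) (sub (liftS s) t)
sub-sub0 s t u = trans
  (sub-sub s (sub0 u) (s ▸ sub s u) (λ { here → refl ; (there x) → refl }) t)
  (sym (sub-sub (sub0 (sub s u)) (liftS s) (s ▸ sub s u) (sub0-lift s (sub s u)) t))

sub-≈ : (s : Sub Γ Δ) {t u : Tm Γ τ} → t ≈ u → sub s t ≈ sub s u
sub-≈ s (β t u) = ≈trans (β (sub (liftS s) t) (sub s u)) (≡⇒≈ (sym (sub-sub0 s t u)))
sub-≈ s (η t)   = ≈trans (η (sub s t))
  (lam≈ (app≈ (≡⇒≈ (sym (sub-lift-↑ s t))) ≈refl))
sub-≈ s ≈refl        = ≈refl
sub-≈ s (≈sym e)     = ≈sym (sub-≈ s e)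
sub-≈ s (≈trans e f) = ≈trans (sub-≈ s e) (sub-≈ s f)
sub-≈ s (lam≈ e)     = lam≈ (sub-≈ (liftS s) e)
sub-≈ s (app≈ e f)   = app≈ (sub-≈ s e) (sub-≈ s f)

ren-≈ : (ρ : Ren Γ Δ) {t u : Tm Γ τ} → t ≈ u → ren ρ t ≈ ren ρ u
ren-≈ ρ {t} {u} e = subst₂ _≈_ (sym (ren-as-sub ρ t)) (sym (ren-as-sub ρ u)) (sub-≈ (renS ρ) e)

lift-≈ : (s u : Sub Γ Δ) → s ≈ₛ u → liftS {α = α} s ≈ₛ liftS u
lift-≈ s u e here      = ≈refl
lift-≈ s u e (there x) = ren-≈ there (e x)

sub-≈ₛ : (s u : Sub Γ Δ) → s ≈ₛ u → (t : Tm Γ τ) → sub s t ≈ sub u t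
sub-≈ₛ s u e (var x)    = e x
sub-≈ₛ s u e (con c)    = ≈refl
sub-≈ₛ s u e (lam t)    = lam≈ (sub-≈ₛ (liftS s) (liftS u) (lift-≈ s u e) t)
sub-≈ₛ s u e (app t t') = app≈ (sub-≈ₛ s u e t) (sub-≈ₛ s u e t')

≈-ext : {M N : Tm Γ (α ⇒ τ)} → ↑ M · v0 ≈ ↑ N · v0 → M ≈ N
≈-ext {M = M} {N} e = ≈trans (η M) (≈trans (lam≈ e) (≈sym (η N)))

-- Iterated lifts, with σ the local signature of a judgment

lift*-≈ : (σ : Ctx) (s u : Sub Γ Δ) → s ≈ₛ u → liftS* σ s ≈ₛ liftS* σ u
lift*-≈ ε       s u e = e
lift*-≈ (σ , _) s u e = lift-≈ (liftS* σ s) (liftS* σ u) (lift*-≈ σ s u e)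

lift*-∘ : (σ : Ctx) (s : Sub Δ Θ) (u : Sub Γ Δ) (v : Sub Γ Θ) → s ∘ₛ u ≗ₛ v →
          liftS* σ s ∘ₛ liftS* σ u ≗ₛ liftS* σ v
lift*-∘ ε       s u v e = e
lift*-∘ (σ , _) s u v e x = trans (lift-∘ (liftS* σ s) (liftS* σ u) x)
  (lift-ext {s = liftS* σ s ∘ₛ liftS* σ u} {u = liftS* σ v} (lift*-∘ σ s u v e) x)

lift*-id : (σ : Ctx) (s : Sub Γ Γ) → s ≗ₛ var → liftS* σ s ≗ₛ var
lift*-id ε       s e = e
lift*-id (σ , _) s e here      = refl
lift*-id (σ , _) s e (there x) = cong ↑ (lift*-id σ s e x)

lift*-ren : (σ : Ctx) (ρ : Ren Γ Δ) → liftS* σ (renS ρ) ≗ₛ renS (liftR* σ ρ)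
lift*-ren ε       ρ x         = refl
lift*-ren (σ , _) ρ here      = refl
lift*-ren (σ , _) ρ (there x) = cong ↑ (lift*-ren σ ρ x)

-- A section of `appAll` up to conversion. It turns a term that may use local variables into a
-- possible value of a raised eigenvariable.
lamAll : (σ : Ctx) → Tm (Γ ++ σ) τ → Tm Γ (raise σ τ)
lamAll ε       t = t
lamAll (σ , α) t = lamAll σ (lam t)

appAll-lamAll : (σ : Ctx) (t : Tm (Γ ++ σ) τ) → appAll σ (lamAll σ t) ≈ t
appAll-lamAll ε       t = ≈refl
appAll-lamAll (σ , α) t =
  ≈trans (app≈ (ren-≈ there (appAll-lamAll σ (lam t))) ≈refl)
  (≈trans (β (ren (liftR there) t) v0)
  (≡⇒≈ (trans (sub-ren (sub0 v0) (liftR there) var (λ { here → refl ; (there _) → refl }) t)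
              (sub-id var (λ _ → refl) t))))

sub-appAll : (σ : Ctx) (s : Sub Γ Δ) (t : Tm Γ (raise σ τ)) →
             sub (liftS* σ s) (appAll σ t) ≡ appAll σ (sub s t)
sub-appAll ε       s t = refl
sub-appAll (σ , α) s t = cong₂ app
  (trans (sub-lift-↑ (liftS* σ s) (appAll σ t)) (cong ↑ (sub-appAll σ s t))) refl

-- Substitution in atoms and formulas

≡⇒≈A : {A B : Atom Γ} → A ≡ B → A ≈A B
≡⇒≈A {A = one P A Q}  refl = one≈ ≈refl ≈refl ≈refl
≡⇒≈A {A = onep P A Q} refl = onep≈ ≈refl ≈refl ≈refl
≡⇒≈A {A = lbisim P Q} refl = lbisim≈ ≈refl ≈refl
≡⇒≈A {A = ebisim P Q} refl = ebisim≈ ≈refl ≈refl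
≡⇒≈A {A = eq τ t u}   refl = eq≈ ≈refl ≈refl

≈A-sym : {A B : Atom Γ} → A ≈A B → B ≈A A
≈A-sym (one≈ a b c)  = one≈ (≈sym a) (≈sym b) (≈sym c)
≈A-sym (onep≈ a b c) = onep≈ (≈sym a) (≈sym b) (≈sym c)
≈A-sym (lbisim≈ a b) = lbisim≈ (≈sym a) (≈sym b)
≈A-sym (ebisim≈ a b) = ebisim≈ (≈sym a) (≈sym b)
≈A-sym (eq≈ a b)     = eq≈ (≈sym a) (≈sym b)

≈A-trans : {A B C : Atom Γ} → A ≈A B → B ≈A C → A ≈A C
≈A-trans (one≈ a b c)  (one≈ a' b' c')  = one≈ (≈trans a a') (≈trans b b') (≈trans c c')
≈A-trans (onep≈ a b c) (onep≈ a' b' c') = onep≈ (≈trans a a') (≈trans b b') (≈trans c c')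
≈A-trans (lbisim≈ a b) (lbisim≈ a' b')  = lbisim≈ (≈trans a a') (≈trans b b')
≈A-trans (ebisim≈ a b) (ebisim≈ a' b')  = ebisim≈ (≈trans a a') (≈trans b b')
≈A-trans (eq≈ a b)     (eq≈ a' b')      = eq≈ (≈trans a a') (≈trans b b')

subA-≈ : (s : Sub Γ Δ) {A B : Atom Γ} → A ≈A B → subA s A ≈A subA s B
subA-≈ s (one≈ a b c)  = one≈ (sub-≈ s a) (sub-≈ s b) (sub-≈ s c)
subA-≈ s (onep≈ a b c) = onep≈ (sub-≈ s a) (sub-≈ s b) (sub-≈ s c)
subA-≈ s (lbisim≈ a b) = lbisim≈ (sub-≈ s a) (sub-≈ s b)
subA-≈ s (ebisim≈ a b) = ebisim≈ (sub-≈ s a) (sub-≈ s b)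
subA-≈ s (eq≈ a b)     = eq≈ (sub-≈ s a) (sub-≈ s b)

subA-≈ₛ : (s u : Sub Γ Δ) → s ≈ₛ u → (A : Atom Γ) → subA s A ≈A subA u A
subA-≈ₛ s u e (one P A Q)  = one≈ (sub-≈ₛ s u e P) (sub-≈ₛ s u e A) (sub-≈ₛ s u e Q)
subA-≈ₛ s u e (onep P A Q) = onep≈ (sub-≈ₛ s u e P) (sub-≈ₛ s u e A) (sub-≈ₛ s u e Q)
subA-≈ₛ s u e (lbisim P Q) = lbisim≈ (sub-≈ₛ s u e P) (sub-≈ₛ s u e Q)
subA-≈ₛ s u e (ebisim P Q) = ebisim≈ (sub-≈ₛ s u e P) (sub-≈ₛ s u e Q)
subA-≈ₛ s u e (eq τ t t')  = eq≈ (sub-≈ₛ s u e t) (sub-≈ₛ s u e t')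

cong₃ : {A B C D : Set} (f : A → B → C → D) {a a' : A} {b b' : B} {c c' : C} →
        a ≡ a' → b ≡ b' → c ≡ c' → f a b c ≡ f a' b' c'
cong₃ f refl refl refl = refl

subA-sub : (s : Sub Δ Θ) (u : Sub Γ Δ) (v : Sub Γ Θ) → s ∘ₛ u ≗ₛ v →
           (A : Atom Γ) → subA s (subA u A) ≡ subA v A
subA-sub s u v e (one P A Q)  = cong₃ one (sub-sub s u v e P) (sub-sub s u v e A) (sub-sub s u v e Q)
subA-sub s u v e (onep P A Q) = cong₃ onep (sub-sub s u v e P) (sub-sub s u v e A) (sub-sub s u v e Q)
subA-sub s u v e (lbisim P Q) = cong₂ lbisim (sub-sub s u v e P) (sub-sub s u v e Q)
subA-sub s u v e (ebisim P Q) = cong₂ ebisim (sub-sub s u v e P) (sub-sub s u v e Q)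
subA-sub s u v e (eq τ t t')  = cong₂ (eq τ) (sub-sub s u v e t) (sub-sub s u v e t')

subA-id : (A : Atom Γ) → subA var A ≡ A
subA-id (one P A Q)  = cong₃ one (sub-id var (λ _ → refl) P) (sub-id var (λ _ → refl) A) (sub-id var (λ _ → refl) Q)
subA-id (onep P A Q) = cong₃ onep (sub-id var (λ _ → refl) P) (sub-id var (λ _ → refl) A) (sub-id var (λ _ → refl) Q)
subA-id (lbisim P Q) = cong₂ lbisim (sub-id var (λ _ → refl) P) (sub-id var (λ _ → refl) Q)
subA-id (ebisim P Q) = cong₂ ebisim (sub-id var (λ _ → refl) P) (sub-id var (λ _ → refl) Q)
subA-id (eq τ t t')  = cong₂ (eq τ) (sub-id var (λ _ → refl) t) (sub-id var (λ _ → refl) t')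

lift-sub-sub : (s : Sub Δ Θ) (u : Sub Γ Δ) (v : Sub Γ Θ) → s ∘ₛ u ≗ₛ v →
               liftS {α = α} s ∘ₛ liftS u ≗ₛ liftS v
lift-sub-sub {α = α} s u v = lift*-∘ (ε , α) s u v

subF-sub : (s : Sub Δ Θ) (u : Sub Γ Δ) (v : Sub Γ Θ) → s ∘ₛ u ≗ₛ v →
           (B : Fm Γ) → subF s (subF u B) ≡ subF v B
subF-sub s u v e (atom A)  = cong atom (subA-sub s u v e A)
subF-sub s u v e ⊤ᶠ        = refl
subF-sub s u v e ⊥ᶠ        = refl
subF-sub s u v e (A ∧ᶠ B)  = cong₂ _∧ᶠ_ (subF-sub s u v e A) (subF-sub s u v e B)
subF-sub s u v e (A ∨ᶠ B)  = cong₂ _∨ᶠ_ (subF-sub s u v e A) (subF-sub s u v e B)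
subF-sub s u v e (A ⊃ᶠ B)  = cong₂ _⊃ᶠ_ (subF-sub s u v e A) (subF-sub s u v e B)
subF-sub s u v e (∀ᶠ τ B)  = cong (∀ᶠ τ) (subF-sub (liftS s) (liftS u) (liftS v) (lift-sub-sub s u v e) B)
subF-sub s u v e (∃ᶠ τ B)  = cong (∃ᶠ τ) (subF-sub (liftS s) (liftS u) (liftS v) (lift-sub-sub s u v e) B)
subF-sub s u v e (∇ᶠ τ B)  = cong (∇ᶠ τ) (subF-sub (liftS s) (liftS u) (liftS v) (lift-sub-sub s u v e) B)

subF-id : (s : Sub Γ Γ) → s ≗ₛ var → (B : Fm Γ) → subF s B ≡ B
subF-id s e (atom A)  = cong atom (trans (cong (subA s) (sym (subA-id A)))
                                  (trans (subA-sub s var var e A) (subA-id A)))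
subF-id s e ⊤ᶠ        = refl
subF-id s e ⊥ᶠ        = refl
subF-id s e (A ∧ᶠ B)  = cong₂ _∧ᶠ_ (subF-id s e A) (subF-id s e B)
subF-id s e (A ∨ᶠ B)  = cong₂ _∨ᶠ_ (subF-id s e A) (subF-id s e B)
subF-id s e (A ⊃ᶠ B)  = cong₂ _⊃ᶠ_ (subF-id s e A) (subF-id s e B)
subF-id s e (∀ᶠ τ B)  = cong (∀ᶠ τ) (subF-id (liftS s) (lift*-id (ε , τ) s e) B)
subF-id s e (∃ᶠ τ B)  = cong (∃ᶠ τ) (subF-id (liftS s) (lift*-id (ε , τ) s e) B)
subF-id s e (∇ᶠ τ B)  = cong (∇ᶠ τ) (subF-id (liftS s) (lift*-id (ε , τ) s e) B)

-- Injectivity of constructors modulo βη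

infix 15 _⟶_ _⟶*_ _~_
-- Weak head reduction, which suffices to expose a head constant and is deterministic.
data _⟶_ {Γ : Ctx} : {τ : Ty} → Tm Γ τ → Tm Γ τ → Set where
  β   : (t : Tm (Γ , α) τ) (u : Tm Γ α) → app (lam t) u ⟶ sub (sub0 u) t
  app : {t t' : Tm Γ (α ⇒ τ)} {u : Tm Γ α} → t ⟶ t' → app t u ⟶ app t' u

data _⟶*_ {Γ : Ctx} {τ : Ty} : Tm Γ τ → Tm Γ τ → Set where
  done : {t : Tm Γ τ} → t ⟶* t
  _∷_  : {t u v : Tm Γ τ} → t ⟶ u → u ⟶* v → t ⟶* v

-- Arguments are compared by conversion only, since one layer of injectivity is all we need.
data _~_ {Γ : Ctx} : {τ : Ty} → Tm Γ τ → Tm Γ τ → Set where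
  var : (x : Γ ∋ τ) → var x ~ var x
  con : (c : Const τ) → con c ~ con c
  app : {t t' : Tm Γ (α ⇒ τ)} {u u' : Tm Γ α} → t ~ t' → u ≈ u' → app t u ~ app t' u'

⟶⇒≈ : {t u : Tm Γ τ} → t ⟶ u → t ≈ u
⟶⇒≈ (β t u) = β t u
⟶⇒≈ (app r) = app≈ (⟶⇒≈ r) ≈refl

⟶*⇒≈ : {t u : Tm Γ τ} → t ⟶* u → t ≈ u
⟶*⇒≈ done     = ≈refl
⟶*⇒≈ (r ∷ rs) = ≈trans (⟶⇒≈ r) (⟶*⇒≈ rs)

~⇒≈ : {t u : Tm Γ τ} → t ~ u → t ≈ u
~⇒≈ (var x)   = ≈refl
~⇒≈ (con c)   = ≈refl
~⇒≈ (app n e) = app≈ (~⇒≈ n) e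

~-sym : {t u : Tm Γ τ} → t ~ u → u ~ t
~-sym (var x)   = var x
~-sym (con c)   = con c
~-sym (app n e) = app (~-sym n) (≈sym e)

~-trans : {t u v : Tm Γ τ} → t ~ u → u ~ v → t ~ v
~-trans (var x)   (var .x)  = var x
~-trans (con c)   (con .c)  = con c
~-trans (app n e) (app m f) = app (~-trans n m) (≈trans e f)

⟶-ren : (ρ : Ren Γ Δ) {t u : Tm Γ τ} → t ⟶ u → ren ρ t ⟶ ren ρ u
⟶-ren ρ (β t u) = subst (app (lam (ren (liftR ρ) t)) (ren ρ u) ⟶_)
  (trans (sub-ren (sub0 (ren ρ u)) (liftR ρ) (renS ρ ▸ ren ρ u)
           (λ { here → refl ; (there _) → refl }) t)
         (sym (ren-sub ρ (sub0 u) (renS ρ ▸ ren ρ u)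
           (λ { here → refl ; (there _) → refl }) t)))
  (β (ren (liftR ρ) t) (ren ρ u))
⟶-ren ρ (app r) = app (⟶-ren ρ r)

⟶*-ren : (ρ : Ren Γ Δ) {t u : Tm Γ τ} → t ⟶* u → ren ρ t ⟶* ren ρ u
⟶*-ren ρ done     = done
⟶*-ren ρ (r ∷ rs) = ⟶-ren ρ r ∷ ⟶*-ren ρ rs

~-ren : (ρ : Ren Γ Δ) {t u : Tm Γ τ} → t ~ u → ren ρ t ~ ren ρ u
~-ren ρ (var x)   = var (ρ x)
~-ren ρ (con c)   = con c
~-ren ρ (app n e) = app (~-ren ρ n) (ren-≈ ρ e)

⟶-det : {t u v : Tm Γ τ} → t ⟶ u → t ⟶ v → u ≡ v
⟶-det (β t u) (β .t .u)  = refl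
⟶-det (app r) (app r')   = cong (λ t → app t _) (⟶-det r r')

~-normal : {t u v : Tm Γ τ} {A : Set} → t ~ u → t ⟶ v → A
~-normal (app n e) (app r) = ~-normal n r

-- Determinism does the work of confluence here. The premises on `~` only say that `u` and `v` are
-- headed by a variable or constant, hence normal.
⟶*-det : {t u v u' v' : Tm Γ τ} → t ⟶* u → u ~ u' → t ⟶* v → v ~ v' → u ≡ v
⟶*-det done     n done      m = refl
⟶*-det done     n (r ∷ _)   m = ~-normal n r
⟶*-det (r ∷ _)  n done      m = ~-normal m r
⟶*-det (r ∷ rs) n (r' ∷ qs) m with refl ← ⟶-det r r' = ⟶*-det rs n qs m

-- A logical relation for βη-conversion

Whnf~ : Tm Γ τ → Tm Γ τ → Set
Whnf~ t u = Σ _ λ p → Σ _ λ q → (t ⟶* p) × (u ⟶* q) × (p ~ q)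

-- A Kripke logical relation over renamings, as in completeness proofs for conversion checking.
-- Renamings are needed at arrow types so that `reify` can apply both sides to a fresh variable.
-- Symmetry and transitivity are proved directly; reflexivity is the fundamental lemma.
_⊩_≋_ : (τ : Ty) → Tm Γ τ → Tm Γ τ → Set
tn ⊩ t ≋ u = Whnf~ t u
ta ⊩ t ≋ u = Whnf~ t u
tp ⊩ t ≋ u = Whnf~ t u
_⊩_≋_ {Γ} (α ⇒ τ) t u = ∀ {Δ} (ρ : Ren Γ Δ) {a b} → α ⊩ a ≋ b → τ ⊩ app (ren ρ t) a ≋ app (ren ρ u) b

whnf~-sym : {t u : Tm Γ τ} → Whnf~ t u → Whnf~ u t
whnf~-sym (p & q & r & r' & n) = (q & p & r' & r & ~-sym n)

whnf~-trans : {t u v : Tm Γ τ} → Whnf~ t u → Whnf~ u v → Whnf~ t v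
whnf~-trans (p & q & r & s & n) (p' & q' & r' & s' & m)
  with refl ← ⟶*-det s (~-sym n) r' m = (p & q' & r & s' & ~-trans n m)

whnf~-ren : (ρ : Ren Γ Δ) {t u : Tm Γ τ} → Whnf~ t u → Whnf~ (ren ρ t) (ren ρ u)
whnf~-ren ρ (p & q & r & s & n) =
  (ren ρ p & ren ρ q & ⟶*-ren ρ r & ⟶*-ren ρ s & ~-ren ρ n)

≋-sym : (τ : Ty) {t u : Tm Γ τ} → τ ⊩ t ≋ u → τ ⊩ u ≋ t
≋-sym tn e = whnf~-sym e
≋-sym ta e = whnf~-sym e
≋-sym tp e = whnf~-sym e
≋-sym (α ⇒ τ) e ρ a = ≋-sym τ (e ρ (≋-sym α a))

≋-trans : (τ : Ty) {t u v : Tm Γ τ} → τ ⊩ t ≋ u → τ ⊩ u ≋ v → τ ⊩ t ≋ v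
≋-trans tn e f = whnf~-trans e f
≋-trans ta e f = whnf~-trans e f
≋-trans tp e f = whnf~-trans e f
≋-trans (α ⇒ τ) e f ρ a = ≋-trans τ (e ρ a) (f ρ (≋-trans α (≋-sym α a) a))

≋-ren : (τ : Ty) (ρ : Ren Γ Δ) {t u : Tm Γ τ} → τ ⊩ t ≋ u → τ ⊩ ren ρ t ≋ ren ρ u
≋-ren tn ρ e = whnf~-ren ρ e
≋-ren ta ρ e = whnf~-ren ρ e
≋-ren tp ρ e = whnf~-ren ρ e
≋-ren (α ⇒ τ) ρ {t} {u} e ρ' {a} {b} r =
  subst₂ (λ x y → τ ⊩ app x a ≋ app y b)
    (sym (ren-ren ρ' ρ (λ x → ρ' (ρ x)) (λ _ → refl) t))
    (sym (ren-ren ρ' ρ (λ x → ρ' (ρ x)) (λ _ → refl) u))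
    (e (λ x → ρ' (ρ x)) r)

≋-expand : (τ : Ty) {t t' u : Tm Γ τ} → t ⟶ t' → τ ⊩ t' ≋ u → τ ⊩ t ≋ u
≋-expand tn r (p & q & rs & e) = (p & q & r ∷ rs & e)
≋-expand ta r (p & q & rs & e) = (p & q & r ∷ rs & e)
≋-expand tp r (p & q & rs & e) = (p & q & r ∷ rs & e)
≋-expand (α ⇒ τ) r e ρ a = ≋-expand τ (app (⟶-ren ρ r)) (e ρ a)

-- Mutual induction on the type: arguments of a neutral term must be reified to keep `~`, and a
-- function is reified by reflecting a variable. Extensionality enters through `≈-ext` at arrow
-- types.
reflect : (τ : Ty) {t u : Tm Γ τ} → t ~ u → τ ⊩ t ≋ u
reify   : (τ : Ty) {t u : Tm Γ τ} → τ ⊩ t ≋ u → t ≈ u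
reflect tn n = (_ & _ & done & done & n)
reflect ta n = (_ & _ & done & done & n)
reflect tp n = (_ & _ & done & done & n)
reflect (α ⇒ τ) n ρ a = reflect τ (app (~-ren ρ n) (reify α a))
reify tn (_ & _ & r & s & n) = ≈trans (⟶*⇒≈ r) (≈trans (~⇒≈ n) (≈sym (⟶*⇒≈ s)))
reify ta (_ & _ & r & s & n) = ≈trans (⟶*⇒≈ r) (≈trans (~⇒≈ n) (≈sym (⟶*⇒≈ s)))
reify tp (_ & _ & r & s & n) = ≈trans (⟶*⇒≈ r) (≈trans (~⇒≈ n) (≈sym (⟶*⇒≈ s)))
reify (α ⇒ τ) e = ≈-ext (reify τ (e there (reflect α (var here))))

_≋ₛ_ : Sub Γ Δ → Sub Γ Δ → Set
s ≋ₛ u = ∀ {τ} (x : _ ∋ τ) → τ ⊩ s x ≋ u x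

β-expand : (ρ : Ren Δ Θ) (s : Sub Γ Δ) (t : Tm (Γ , α) τ) (a : Tm Θ α) {u : Tm Θ τ} →
           τ ⊩ sub ((λ x → ren ρ (s x)) ▸ a) t ≋ u → τ ⊩ app (ren ρ (sub s (lam t))) a ≋ u
β-expand {τ = τ} ρ s t a {u} e = ≋-expand τ (β _ a) (subst (λ z → τ ⊩ z ≋ u) (sym eq') e)
  where
  eq' : sub (sub0 a) (ren (liftR ρ) (sub (liftS s) t)) ≡ sub ((λ x → ren ρ (s x)) ▸ a) t
  eq' = trans (cong (sub (sub0 a)) (ren-sub (liftR ρ) (liftS s) (liftS (λ x → ren ρ (s x)))
                (λ { here → refl
                   ; (there x) → trans (ren-ren (liftR ρ) there (λ y → there (ρ y)) (λ _ → refl) (s x))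
                                       (sym (ren-ren there ρ (λ y → there (ρ y)) (λ _ → refl) (s x))) }) t))
              (sub-sub (sub0 a) (liftS (λ x → ren ρ (s x))) ((λ x → ren ρ (s x)) ▸ a)
                (sub0-lift (λ x → ren ρ (s x)) a) t)

≋-extend : (ρ : Ren Δ Θ) (s u : Sub Γ Δ) → s ≋ₛ u → {a b : Tm Θ α} → α ⊩ a ≋ b →
           ((λ x → ren ρ (s x)) ▸ a) ≋ₛ ((λ x → ren ρ (u x)) ▸ b)
≋-extend ρ s u e r here      = r
≋-extend ρ s u e r (there x) = ≋-ren _ ρ (e x)

≋-refl : (s u : Sub Γ Δ) → s ≋ₛ u → (t : Tm Γ τ) → τ ⊩ sub s t ≋ sub u t
≋-refl s u e (var x) = e x
≋-refl s u e (con c) = reflect _ (con c)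
≋-refl {τ = α ⇒ τ} s u e (lam t) ρ {a} {b} r =
  β-expand ρ s t a (≋-sym τ (β-expand ρ u t b (≋-sym τ
    (≋-refl ((λ x → ren ρ (s x)) ▸ a) ((λ x → ren ρ (u x)) ▸ b) (≋-extend ρ s u e r) t))))
≋-refl {τ = τ} s u e (app {α = α} t t') =
  subst₂ (λ x y → τ ⊩ app x (sub s t') ≋ app y (sub u t')) (ren-id (sub s t)) (ren-id (sub u t))
    (≋-refl s u e t (λ x → x) (≋-refl s u e t'))

-- The fundamental lemma for conversion. It uses two related environments, because under `lam` the
-- two sides receive related but different arguments.
≈⇒≋ : (s u : Sub Γ Δ) → s ≋ₛ u → {t t' : Tm Γ τ} → t ≈ t' → τ ⊩ sub s t ≋ sub u t'
≈⇒≋ {τ = τ} s u e (β t t') =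
  ≋-expand τ (β (sub (liftS s) t) (sub s t'))
    (subst (λ z → τ ⊩ z ≋ sub u (sub (sub0 t') t)) (sub-sub0 s t t') (≋-refl s u e (sub (sub0 t') t)))
≈⇒≋ {τ = α ⇒ τ} s u e (η t) ρ {a} {b} r = ≋-sym τ (β-expand ρ u (app (↑ t) v0) b
  (≋-sym τ (subst (λ z → τ ⊩ app (ren ρ (sub s t)) a ≋ app z b)
    (trans (ren-sub ρ u (λ x → ren ρ (u x)) (λ _ → refl) t)
           (sym (sub-↑ ((λ x → ren ρ (u x)) ▸ b) t)))
    (≋-refl s u e t ρ r))))
≈⇒≋ s u e {t} ≈refl = ≋-refl s u e t
≈⇒≋ s u e (≈sym p) = ≋-sym _ (≈⇒≋ u s (λ x → ≋-sym _ (e x)) p)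
-- The middle term needs `u` related to itself, which symmetry and transitivity extract from `e`.
≈⇒≋ s u e (≈trans p q) = ≋-trans _ (≈⇒≋ s u e p)
  (≈⇒≋ u u (λ x → ≋-trans _ (≋-sym _ (e x)) (e x)) q)
≈⇒≋ {τ = α ⇒ τ} s u e (lam≈ {t = t} {t'} p) ρ {a} {b} r =
  β-expand ρ s t a (≋-sym τ (β-expand ρ u t' b (≋-sym τ
    (≈⇒≋ ((λ x → ren ρ (s x)) ▸ a) ((λ x → ren ρ (u x)) ▸ b) (≋-extend ρ s u e r) p))))
≈⇒≋ {τ = τ} s u e (app≈ {t = t} {t'} {u = v} {v'} p q) =
  subst₂ (λ x y → τ ⊩ app x (sub s v) ≋ app y (sub u v')) (ren-id (sub s t)) (ren-id (sub u t'))
    (≈⇒≋ s u e p (λ x → x) (≈⇒≋ s u e q))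

data Rigid {Γ : Ctx} : {τ : Ty} → Tm Γ τ → Set where
  con : (c : Const τ) → Rigid (con c)
  app : {t : Tm Γ (α ⇒ τ)} {u : Tm Γ α} → Rigid t → Rigid (app t u)

rigid-~ : {t : Tm Γ τ} → Rigid t → t ~ t
rigid-~ (con c) = con c
rigid-~ (app r) = app (rigid-~ r) ≈refl

data Base : Ty → Set where
  ta : Base ta
  tp : Base tp

-- A term headed by a constant is its own weak head normal form, so the normal forms recorded by the
-- logical relation must be the two given terms. At a base type the relation unfolds to exactly such
-- a record.
rigid-inj : Base τ → {t u : Tm Γ τ} → Rigid t → Rigid u → t ≈ u → t ~ u
rigid-inj {τ} {Γ} b {t} {u} r r' e = whnf b (subst₂ (λ x y → τ ⊩ x ≋ y)
    (sub-id var (λ _ → refl) t) (sub-id var (λ _ → refl) u)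
    (≈⇒≋ var var (λ x → reflect _ (var x)) e))
  where
  unique : Whnf~ t u → t ~ u
  unique (p & q & rs & rs' & n)
    with refl ← ⟶*-det done (rigid-~ r) rs n | refl ← ⟶*-det done (rigid-~ r') rs' (~-sym n) = n
  whnf : Base τ → τ ⊩ t ≋ u → t ~ u
  whnf ta = unique
  whnf tp = unique

-- Kripke semantics

-- Goal formulas need no distinction between global and local variables.
Goal : (∀ {Γ} → Atom Γ → Set) → Sub Γ Δ → Fm Γ → Set
Goal X s (atom A)  = X (subA s A)
Goal X s ⊤ᶠ        = ⊤
Goal X s (A ∧ᶠ B)  = Goal X s A × Goal X s B
Goal {Δ = Δ} X s (∃ᶠ τ B) = Σ (Tm Δ τ) λ t → Goal X (s ▸ t) B
Goal X s (∇ᶠ τ B)  = Goal X (liftS s) B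
Goal X s ⊥ᶠ        = ⊥
Goal X s (A ∨ᶠ B)  = ⊥
Goal X s (A ⊃ᶠ B)  = ⊥
Goal X s (∀ᶠ τ B)  = ⊥

-- Truth of a transition is derivability by right rules alone. Because `Goal` is empty at ⊃ and ∀,
-- no bisimilarity atom holds in this sense and the recursion is strictly positive.
data Holds {Γ : Ctx} : Atom Γ → Set where
  def : ∀ {A} (c : Clause) → Dπ c → (θ : Sub (ctx c) Γ) → A ≈A subA θ (head c) →
        Goal Holds θ (body c) → Holds A

-- This reflects the stratification of the definition: transitions and equality are already fixed by
-- `Holds`, and only the bisimilarity atoms are left to the parameter.
True : ((Θ σ : Ctx) → Atom (Θ ++ σ) → Set) → (Θ σ : Ctx) → Atom (Θ ++ σ) → Set
True X Θ σ (one P A Q)  = Holds (one P A Q)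
True X Θ σ (onep P A Q) = Holds (onep P A Q)
True X Θ σ (eq τ t u)   = Holds (eq τ t u)
True X Θ σ (lbisim P Q) = X Θ σ (lbisim P Q)
True X Θ σ (ebisim P Q) = X Θ σ (ebisim P Q)

-- Forcing for formulas whose implications have goal antecedents, which keeps X strictly positive.
Forces⁺ : ((Θ σ : Ctx) → Atom (Θ ++ σ) → Set) → (Θ σ : Ctx) → Sub Γ (Θ ++ σ) → Fm Γ → Set
Forces⁺ X Θ σ s (atom A) = True X Θ σ (subA s A)
Forces⁺ X Θ σ s ⊤ᶠ       = ⊤
Forces⁺ X Θ σ s ⊥ᶠ       = ⊥
Forces⁺ X Θ σ s (A ∧ᶠ B) = Forces⁺ X Θ σ s A × Forces⁺ X Θ σ s B
Forces⁺ X Θ σ s (A ∨ᶠ B) = Forces⁺ X Θ σ s A ⊎ Forces⁺ X Θ σ s B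
Forces⁺ X Θ σ s (A ⊃ᶠ B) = ∀ {Θ'} (r : Sub Θ Θ') → Goal Holds (liftS* σ r ∘ₛ s) A →
                           Forces⁺ X Θ' σ (liftS* σ r ∘ₛ s) B
Forces⁺ X Θ σ s (∀ᶠ τ B) = ∀ {Θ'} (r : Sub Θ Θ') (t : Tm (Θ' ++ σ) τ) →
                           Forces⁺ X Θ' σ ((liftS* σ r ∘ₛ s) ▸ t) B
Forces⁺ X Θ σ s (∃ᶠ τ B) = Σ (Tm (Θ ++ σ) τ) λ t → Forces⁺ X Θ σ (s ▸ t) B
Forces⁺ X Θ σ s (∇ᶠ τ B) = Forces⁺ X Θ (σ , τ) (liftS s) B

-- `Θ` and `σ` are kept apart, unlike in `Holds`, because the quantifiers inside the body move to
-- stages that instantiate `Θ` while `σ` stays fixed. Storing the head only up to conversion makes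
-- closure under conversion immediate.
data Bisim (Θ σ : Ctx) (A : Atom (Θ ++ σ)) : Set where
  unfoldˡ : (θ : Sub (ε , tp , tp) (Θ ++ σ)) → A ≈A subA θ (lbisim v1 v0) →
            Forces⁺ Bisim Θ σ θ (lbisimBody v1 v0) → Bisim Θ σ A
  unfoldᵉ : (θ : Sub (ε , tp , tp) (Θ ++ σ)) → A ≈A subA θ (ebisim v1 v0) →
            Forces⁺ Bisim Θ σ θ (ebisimBody v1 v0) → Bisim Θ σ A

-- The forcing relation at stage Θ; for the bodies of the clauses it unfolds to Forces⁺ Bisim.
Forces : (Θ σ : Ctx) → Sub Γ (Θ ++ σ) → Fm Γ → Set
Forces Θ σ s (atom A) = True Bisim Θ σ (subA s A)
Forces Θ σ s ⊤ᶠ       = ⊤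
Forces Θ σ s ⊥ᶠ       = ⊥
Forces Θ σ s (A ∧ᶠ B) = Forces Θ σ s A × Forces Θ σ s B
Forces Θ σ s (A ∨ᶠ B) = Forces Θ σ s A ⊎ Forces Θ σ s B
Forces Θ σ s (A ⊃ᶠ B) = ∀ {Θ'} (r : Sub Θ Θ') → Forces Θ' σ (liftS* σ r ∘ₛ s) A →
                        Forces Θ' σ (liftS* σ r ∘ₛ s) B
Forces Θ σ s (∀ᶠ τ B) = ∀ {Θ'} (r : Sub Θ Θ') (t : Tm (Θ' ++ σ) τ) →
                        Forces Θ' σ ((liftS* σ r ∘ₛ s) ▸ t) B
Forces Θ σ s (∃ᶠ τ B) = Σ (Tm (Θ ++ σ) τ) λ t → Forces Θ σ (s ▸ t) B
Forces Θ σ s (∇ᶠ τ B) = Forces Θ (σ , τ) (liftS s) B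

-- Invariance of forcing under conversion, transitions and substitution

holds-≈ : {A B : Atom Γ} → A ≈A B → Holds A → Holds B
holds-≈ e (def c d θ f p) = def c d θ (≈A-trans (≈A-sym e) f) p

bisim-≈ : {A B : Atom (Θ ++ σ)} → A ≈A B → Bisim Θ σ A → Bisim Θ σ B
bisim-≈ e (unfoldˡ θ f p) = unfoldˡ θ (≈A-trans (≈A-sym e) f) p
bisim-≈ e (unfoldᵉ θ f p) = unfoldᵉ θ (≈A-trans (≈A-sym e) f) p

true-≈ : (Θ σ : Ctx) {A B : Atom (Θ ++ σ)} → A ≈A B → True Bisim Θ σ A → True Bisim Θ σ B
true-≈ Θ σ e@(one≈ _ _ _)  = holds-≈ e
true-≈ Θ σ e@(onep≈ _ _ _) = holds-≈ e
true-≈ Θ σ e@(eq≈ _ _)     = holds-≈ e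
true-≈ Θ σ e@(lbisim≈ _ _) = bisim-≈ {Θ = Θ} {σ} e
true-≈ Θ σ e@(ebisim≈ _ _) = bisim-≈ {Θ = Θ} {σ} e

▸-≈ : (s u : Sub Γ Δ) → s ≈ₛ u → {t : Tm Δ τ} → (s ▸ t) ≈ₛ (u ▸ t)
▸-≈ s u e here      = ≈refl
▸-≈ s u e (there x) = e x

∘-≈ : (r : Sub Δ Θ) (s u : Sub Γ Δ) → s ≈ₛ u → (r ∘ₛ s) ≈ₛ (r ∘ₛ u)
∘-≈ r s u e x = sub-≈ r (e x)

▸-∘-lift : (s : Sub Δ Θ) (u : Sub Γ Δ) (v : Sub Γ Θ) → (s ∘ₛ u) ≈ₛ v → {t : Tm Θ τ} →
           ((s ▸ t) ∘ₛ liftS u) ≈ₛ (v ▸ t)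
▸-∘-lift s u v e here      = ≈refl
▸-∘-lift s u v e (there x) = ≈trans (≡⇒≈ (sub-↑ (s ▸ _) (u x))) (e x)

lift-∘-≈ : (s : Sub Δ Θ) (u : Sub Γ Δ) (v : Sub Γ Θ) → (s ∘ₛ u) ≈ₛ v →
           (liftS {α = α} s ∘ₛ liftS u) ≈ₛ liftS v
lift-∘-≈ s u v e x = ≈trans (≡⇒≈ (lift-∘ s u x)) (lift-≈ (s ∘ₛ u) v e x)

∘-assoc-≈ : (r : Sub Θ Ψ) (s : Sub Δ Θ) (u : Sub Γ Δ) (v : Sub Γ Θ) → (s ∘ₛ u) ≈ₛ v →
            ((r ∘ₛ s) ∘ₛ u) ≈ₛ (r ∘ₛ v)
∘-assoc-≈ r s u v e x = ≈trans (≡⇒≈ (sym (sub-sub r s (r ∘ₛ s) (λ _ → refl) (u x)))) (sub-≈ r (e x))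

lift*-∘-assoc : (σ : Ctx) (r' : Sub Θ' Ψ) (r : Sub Θ Θ') (s : Sub Γ (Θ ++ σ)) →
                (liftS* σ (r' ∘ₛ r) ∘ₛ s) ≗ₛ (liftS* σ r' ∘ₛ liftS* σ r ∘ₛ s)
lift*-∘-assoc σ r' r s x = sym (sub-sub (liftS* σ r') (liftS* σ r) (liftS* σ (r' ∘ₛ r))
                                        (lift*-∘ σ r' r (r' ∘ₛ r) (λ _ → refl)) (s x))

≡⇒≈ₛ : (s u : Sub Γ Δ) → s ≗ₛ u → s ≈ₛ u
≡⇒≈ₛ s u e x = ≡⇒≈ (e x)

≈ₛ-sym : (s u : Sub Γ Δ) → s ≈ₛ u → u ≈ₛ s
≈ₛ-sym s u e x = ≈sym (e x)

forces-≈ : (B : Fm Γ) (Θ σ : Ctx) (s u : Sub Γ (Θ ++ σ)) → s ≈ₛ u → Forces Θ σ s B → Forces Θ σ u B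
forces-≈ (atom A) Θ σ s u e p = true-≈ Θ σ (subA-≈ₛ s u e A) p
forces-≈ ⊤ᶠ       Θ σ s u e p = p
forces-≈ (A ∧ᶠ B) Θ σ s u e (p & q) = forces-≈ A Θ σ s u e p & forces-≈ B Θ σ s u e q
forces-≈ (A ∨ᶠ B) Θ σ s u e (inj₁ p) = inj₁ (forces-≈ A Θ σ s u e p)
forces-≈ (A ∨ᶠ B) Θ σ s u e (inj₂ p) = inj₂ (forces-≈ B Θ σ s u e p)
forces-≈ (A ⊃ᶠ B) Θ σ s u e p {Θ'} r a =
  forces-≈ B Θ' σ s' u' e' (p r (forces-≈ A Θ' σ u' s' (≈ₛ-sym s' u' e') a))
  where
  s' = liftS* σ r ∘ₛ s
  u' = liftS* σ r ∘ₛ u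
  e' = ∘-≈ (liftS* σ r) s u e
forces-≈ (∀ᶠ τ B) Θ σ s u e p {Θ'} r t =
  forces-≈ B Θ' σ _ _ (▸-≈ (liftS* σ r ∘ₛ s) (liftS* σ r ∘ₛ u) (∘-≈ (liftS* σ r) s u e)) (p r t)
forces-≈ (∃ᶠ τ B) Θ σ s u e (t & p) = t & forces-≈ B Θ σ (s ▸ t) (u ▸ t) (▸-≈ s u e) p
forces-≈ (∇ᶠ τ B) Θ σ s u e p = forces-≈ B Θ (σ , τ) (liftS s) (liftS u) (lift-≈ s u e) p

-- Clauses are schematic and no clause tests that two names differ, so a substitution acts on the
-- whole derivation of a transition even when it identifies names.
holds-sub : (r : Sub Γ Δ) {A : Atom Γ} → Holds A → Holds (subA r A)
goal-sub  : (B : Fm Γ) (r : Sub Δ Θ) (s : Sub Γ Δ) (u : Sub Γ Θ) → (r ∘ₛ s) ≈ₛ u →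
            Goal Holds s B → Goal Holds u B
holds-sub r (def c d θ e p) = def c d (r ∘ₛ θ)
  (≈A-trans (subA-≈ r e) (≡⇒≈A (subA-sub r θ (r ∘ₛ θ) (λ _ → refl) (head c))))
  (goal-sub (body c) r θ (r ∘ₛ θ) (λ _ → ≈refl) p)
goal-sub (atom A) r s u e p = holds-≈
  (≈A-trans (≡⇒≈A (subA-sub r s (r ∘ₛ s) (λ _ → refl) A)) (subA-≈ₛ (r ∘ₛ s) u e A)) (holds-sub r p)
goal-sub ⊤ᶠ       r s u e p = p
goal-sub (A ∧ᶠ B) r s u e (p & q) = goal-sub A r s u e p & goal-sub B r s u e q
goal-sub (∃ᶠ τ B) r s u e (t & p) = sub r t & goal-sub B r (s ▸ t) (u ▸ sub r t)
  (λ { here → ≈refl ; (there x) → e x }) p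
goal-sub (∇ᶠ τ B) r s u e p = goal-sub B (liftS r) (liftS s) (liftS u) (lift-∘-≈ r s u e) p

-- Kripke monotonicity. Each conjunct of a bisimilarity body starts with ∀, which already speaks of
-- all later stages, so there the transitions are merely composed.
true-mono   : {Θ Θ' : Ctx} (σ : Ctx) (r : Sub Θ Θ') (A : Atom (Θ ++ σ)) →
              True Bisim Θ σ A → True Bisim Θ' σ (subA (liftS* σ r) A)
bisim-mono  : {Θ Θ' : Ctx} (σ : Ctx) (r : Sub Θ Θ') {A : Atom (Θ ++ σ)} →
              Bisim Θ σ A → Bisim Θ' σ (subA (liftS* σ r) A)
forces-mono : (B : Fm Γ) {Θ Θ' : Ctx} (σ : Ctx) (r : Sub Θ Θ') (s : Sub Γ (Θ ++ σ)) →
              Forces Θ σ s B → Forces Θ' σ (liftS* σ r ∘ₛ s) B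
true-mono σ r (one P A Q)  p = holds-sub (liftS* σ r) p
true-mono σ r (onep P A Q) p = holds-sub (liftS* σ r) p
true-mono σ r (eq τ t u)   p = holds-sub (liftS* σ r) p
true-mono σ r (lbisim P Q) p = bisim-mono σ r p
true-mono σ r (ebisim P Q) p = bisim-mono σ r p
bisim-mono σ r (unfoldˡ θ e p) =
  unfoldˡ (liftS* σ r ∘ₛ θ) (subA-≈ (liftS* σ r) e) (forces-mono (lbisimBody v1 v0) σ r θ p)
bisim-mono σ r (unfoldᵉ θ e p) =
  unfoldᵉ (liftS* σ r ∘ₛ θ) (subA-≈ (liftS* σ r) e) (forces-mono (ebisimBody v1 v0) σ r θ p)
forces-mono (atom A) {Θ' = Θ'} σ r s p = true-≈ Θ' σ
  (≡⇒≈A (subA-sub (liftS* σ r) s (liftS* σ r ∘ₛ s) (λ _ → refl) A)) (true-mono σ r (subA s A) p)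
forces-mono ⊤ᶠ       σ r s p = p
forces-mono (A ∧ᶠ B) σ r s (p & q) = forces-mono A σ r s p & forces-mono B σ r s q
forces-mono (A ∨ᶠ B) σ r s (inj₁ p) = inj₁ (forces-mono A σ r s p)
forces-mono (A ∨ᶠ B) σ r s (inj₂ p) = inj₂ (forces-mono B σ r s p)
forces-mono (A ⊃ᶠ B) σ r s p {Θ''} r' a =
  forces-≈ B Θ'' σ _ _ (≡⇒≈ₛ s₁ s₂ e) (p (r' ∘ₛ r) (forces-≈ A Θ'' σ _ _ (≈ₛ-sym s₁ s₂ (≡⇒≈ₛ s₁ s₂ e)) a))
  where
  s₁ = liftS* σ (r' ∘ₛ r) ∘ₛ s
  s₂ = liftS* σ r' ∘ₛ liftS* σ r ∘ₛ s
  e  = lift*-∘-assoc σ r' r s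
forces-mono (∀ᶠ τ B) σ r s p {Θ''} r' t =
  forces-≈ B Θ'' σ _ _ (▸-≈ s₁ s₂ (≡⇒≈ₛ s₁ s₂ (lift*-∘-assoc σ r' r s))) (p (r' ∘ₛ r) t)
  where
  s₁ = liftS* σ (r' ∘ₛ r) ∘ₛ s
  s₂ = liftS* σ r' ∘ₛ liftS* σ r ∘ₛ s
forces-mono (∃ᶠ τ B) {Θ' = Θ'} σ r s (t & p) = sub (liftS* σ r) t &
  forces-≈ B Θ' σ (liftS* σ r ∘ₛ (s ▸ t)) _ (λ { here → ≈refl ; (there x) → ≈refl })
    (forces-mono B σ r (s ▸ t) p)
forces-mono (∇ᶠ τ B) {Θ' = Θ'} σ r s p =
  forces-≈ B Θ' (σ , τ) _ _
    (≡⇒≈ₛ (liftS (liftS* σ r) ∘ₛ liftS s) (liftS (liftS* σ r ∘ₛ s)) (lift-∘ (liftS* σ r) s))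
    (forces-mono B (σ , τ) r (liftS s) p)

-- Both directions are proved together since the antecedent of an implication is traversed the
-- opposite way.
forces-sub⁻ : (B : Fm Γ) (Θ σ : Ctx) (s : Sub Δ (Θ ++ σ)) (u : Sub Γ Δ) (v : Sub Γ (Θ ++ σ)) →
              (s ∘ₛ u) ≈ₛ v → Forces Θ σ s (subF u B) → Forces Θ σ v B
forces-sub⁺ : (B : Fm Γ) (Θ σ : Ctx) (s : Sub Δ (Θ ++ σ)) (u : Sub Γ Δ) (v : Sub Γ (Θ ++ σ)) →
              (s ∘ₛ u) ≈ₛ v → Forces Θ σ v B → Forces Θ σ s (subF u B)
forces-sub⁻ (atom A) Θ σ s u v e p = true-≈ Θ σ
  (≈A-trans (≡⇒≈A (subA-sub s u (s ∘ₛ u) (λ _ → refl) A)) (subA-≈ₛ (s ∘ₛ u) v e A)) p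
forces-sub⁻ ⊤ᶠ       Θ σ s u v e p = p
forces-sub⁻ (A ∧ᶠ B) Θ σ s u v e (p & q) = forces-sub⁻ A Θ σ s u v e p & forces-sub⁻ B Θ σ s u v e q
forces-sub⁻ (A ∨ᶠ B) Θ σ s u v e (inj₁ p) = inj₁ (forces-sub⁻ A Θ σ s u v e p)
forces-sub⁻ (A ∨ᶠ B) Θ σ s u v e (inj₂ p) = inj₂ (forces-sub⁻ B Θ σ s u v e p)
forces-sub⁻ (A ⊃ᶠ B) Θ σ s u v e p {Θ'} r a =
  forces-sub⁻ B Θ' σ s' u v' e' (p r (forces-sub⁺ A Θ' σ s' u v' e' a))
  where
  s' = liftS* σ r ∘ₛ s
  v' = liftS* σ r ∘ₛ v
  e' = ∘-assoc-≈ (liftS* σ r) s u v e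
forces-sub⁻ (∀ᶠ τ B) Θ σ s u v e p {Θ'} r t = forces-sub⁻ B Θ' σ _ _ _
  (▸-∘-lift (liftS* σ r ∘ₛ s) u (liftS* σ r ∘ₛ v) (∘-assoc-≈ (liftS* σ r) s u v e)) (p r t)
forces-sub⁻ (∃ᶠ τ B) Θ σ s u v e (t & p) = t & forces-sub⁻ B Θ σ _ _ _ (▸-∘-lift s u v e) p
forces-sub⁻ (∇ᶠ τ B) Θ σ s u v e p = forces-sub⁻ B Θ (σ , τ) _ _ _ (lift-∘-≈ s u v e) p
forces-sub⁺ (atom A) Θ σ s u v e p = true-≈ Θ σ (≈A-sym
  (≈A-trans (≡⇒≈A (subA-sub s u (s ∘ₛ u) (λ _ → refl) A)) (subA-≈ₛ (s ∘ₛ u) v e A))) p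
forces-sub⁺ ⊤ᶠ       Θ σ s u v e p = p
forces-sub⁺ (A ∧ᶠ B) Θ σ s u v e (p & q) = forces-sub⁺ A Θ σ s u v e p & forces-sub⁺ B Θ σ s u v e q
forces-sub⁺ (A ∨ᶠ B) Θ σ s u v e (inj₁ p) = inj₁ (forces-sub⁺ A Θ σ s u v e p)
forces-sub⁺ (A ∨ᶠ B) Θ σ s u v e (inj₂ p) = inj₂ (forces-sub⁺ B Θ σ s u v e p)
forces-sub⁺ (A ⊃ᶠ B) Θ σ s u v e p {Θ'} r a =
  forces-sub⁺ B Θ' σ s' u v' e' (p r (forces-sub⁻ A Θ' σ s' u v' e' a))
  where
  s' = liftS* σ r ∘ₛ s
  v' = liftS* σ r ∘ₛ v
  e' = ∘-assoc-≈ (liftS* σ r) s u v e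
forces-sub⁺ (∀ᶠ τ B) Θ σ s u v e p {Θ'} r t = forces-sub⁺ B Θ' σ _ _ _
  (▸-∘-lift (liftS* σ r ∘ₛ s) u (liftS* σ r ∘ₛ v) (∘-assoc-≈ (liftS* σ r) s u v e)) (p r t)
forces-sub⁺ (∃ᶠ τ B) Θ σ s u v e (t & p) = t & forces-sub⁺ B Θ σ _ _ _ (▸-∘-lift s u v e) p
forces-sub⁺ (∇ᶠ τ B) Θ σ s u v e p = forces-sub⁺ B Θ (σ , τ) _ _ _ (lift-∘-≈ s u v e) p

≈F-sym : {A B : Fm Γ} → A ≈F B → B ≈F A
≈F-sym (atom≈ e) = atom≈ (≈A-sym e)
≈F-sym ⊤≈        = ⊤≈
≈F-sym ⊥≈        = ⊥≈
≈F-sym (∧≈ a b)  = ∧≈ (≈F-sym a) (≈F-sym b)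
≈F-sym (∨≈ a b)  = ∨≈ (≈F-sym a) (≈F-sym b)
≈F-sym (⊃≈ a b)  = ⊃≈ (≈F-sym a) (≈F-sym b)
≈F-sym (∀≈ b)    = ∀≈ (≈F-sym b)
≈F-sym (∃≈ b)    = ∃≈ (≈F-sym b)
≈F-sym (∇≈ b)    = ∇≈ (≈F-sym b)

forces-≈F : {A B : Fm Γ} (Θ σ : Ctx) (s : Sub Γ (Θ ++ σ)) → A ≈F B → Forces Θ σ s A → Forces Θ σ s B
forces-≈F Θ σ s (atom≈ e) p = true-≈ Θ σ (subA-≈ s e) p
forces-≈F Θ σ s ⊤≈        p = p
forces-≈F Θ σ s (∧≈ a b)  (p & q) = forces-≈F Θ σ s a p & forces-≈F Θ σ s b q
forces-≈F Θ σ s (∨≈ a b)  (inj₁ p) = inj₁ (forces-≈F Θ σ s a p)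
forces-≈F Θ σ s (∨≈ a b)  (inj₂ p) = inj₂ (forces-≈F Θ σ s b p)
forces-≈F Θ σ s (⊃≈ a b)  p {Θ'} r q = forces-≈F Θ' σ _ b (p r (forces-≈F Θ' σ _ (≈F-sym a) q))
forces-≈F Θ σ s (∀≈ b)    p {Θ'} r t = forces-≈F Θ' σ _ b (p r t)
forces-≈F Θ σ s (∃≈ b)    (t & p) = t & forces-≈F Θ σ _ b p
forces-≈F Θ σ s (∇≈ b)    p = forces-≈F Θ (σ , _) _ b p

-- By cases on the clause so that everything computes: on the bodies of the transition clauses,
-- `Forces` and `Goal Holds` reduce to the same type.
fold : {c : Clause} → Dπ c → (Θ σ : Ctx) (θ : Sub (ctx c) (Θ ++ σ)) →
       Forces Θ σ θ (body c) → True Bisim Θ σ (subA θ (head c))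
fold d@c-tau    Θ σ θ p = def _ d θ (≡⇒≈A refl) p
fold d@c-in     Θ σ θ p = def _ d θ (≡⇒≈A refl) p
fold d@c-out    Θ σ θ p = def _ d θ (≡⇒≈A refl) p
fold d@c-match  Θ σ θ p = def _ d θ (≡⇒≈A refl) p
fold d@c-matchp Θ σ θ p = def _ d θ (≡⇒≈A refl) p
fold d@c-sumL   Θ σ θ p = def _ d θ (≡⇒≈A refl) p
fold d@c-sumR   Θ σ θ p = def _ d θ (≡⇒≈A refl) p
fold d@c-sumLp  Θ σ θ p = def _ d θ (≡⇒≈A refl) p
fold d@c-sumRp  Θ σ θ p = def _ d θ (≡⇒≈A refl) p
fold d@c-parL   Θ σ θ p = def _ d θ (≡⇒≈A refl) p
fold d@c-parR   Θ σ θ p = def _ d θ (≡⇒≈A refl) p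
fold d@c-parLp  Θ σ θ p = def _ d θ (≡⇒≈A refl) p
fold d@c-parRp  Θ σ θ p = def _ d θ (≡⇒≈A refl) p
fold d@c-res    Θ σ θ p = def _ d θ (≡⇒≈A refl) p
fold d@c-resp   Θ σ θ p = def _ d θ (≡⇒≈A refl) p
fold d@c-open   Θ σ θ p = def _ d θ (≡⇒≈A refl) p
fold d@c-close₁ Θ σ θ p = def _ d θ (≡⇒≈A refl) p
fold d@c-close₂ Θ σ θ p = def _ d θ (≡⇒≈A refl) p
fold d@c-com₁   Θ σ θ p = def _ d θ (≡⇒≈A refl) p
fold d@c-com₂   Θ σ θ p = def _ d θ (≡⇒≈A refl) p
fold d@(c-eq τ) Θ σ θ p = def _ d θ (≡⇒≈A refl) p
fold c-lbisim   Θ σ θ p = unfoldˡ θ (≡⇒≈A refl) p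
fold c-ebisim   Θ σ θ p = unfoldᵉ θ (≡⇒≈A refl) p

goal⇒forces : {c : Clause} → Dπ c → (Θ σ : Ctx) (θ : Sub (ctx c) (Θ ++ σ)) →
              Goal Holds θ (body c) → Forces Θ σ θ (body c)
goal⇒forces c-tau    Θ σ θ p = p
goal⇒forces c-in     Θ σ θ p = p
goal⇒forces c-out    Θ σ θ p = p
goal⇒forces c-match  Θ σ θ p = p
goal⇒forces c-matchp Θ σ θ p = p
goal⇒forces c-sumL   Θ σ θ p = p
goal⇒forces c-sumR   Θ σ θ p = p
goal⇒forces c-sumLp  Θ σ θ p = p
goal⇒forces c-sumRp  Θ σ θ p = p
goal⇒forces c-parL   Θ σ θ p = p
goal⇒forces c-parR   Θ σ θ p = p
goal⇒forces c-parLp  Θ σ θ p = p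
goal⇒forces c-parRp  Θ σ θ p = p
goal⇒forces c-res    Θ σ θ p = p
goal⇒forces c-resp   Θ σ θ p = p
goal⇒forces c-open   Θ σ θ p = p
goal⇒forces c-close₁ Θ σ θ p = p
goal⇒forces c-close₂ Θ σ θ p = p
goal⇒forces c-com₁   Θ σ θ p = p
goal⇒forces c-com₂   Θ σ θ p = p
goal⇒forces (c-eq τ) Θ σ θ p = p
goal⇒forces c-lbisim Θ σ θ ((() & _) & _)
goal⇒forces c-ebisim Θ σ θ ((() & _) & _)

record Unfolding (Θ σ : Ctx) (A : Atom (Θ ++ σ)) : Set where
  constructor unf
  field
    {c}  : Clause
    d    : Dπ c
    θ    : Sub (ctx c) (Θ ++ σ)
    eqn  : A ≈A subA θ (head c)
    holds : Forces Θ σ θ (body c)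

unfold-holds : (Θ σ : Ctx) {A : Atom (Θ ++ σ)} → Holds A → Unfolding Θ σ A
unfold-holds Θ σ (def c d θ e p) = unf d θ e (goal⇒forces d Θ σ θ p)

unfold-bisim : (Θ σ : Ctx) {A : Atom (Θ ++ σ)} → Bisim Θ σ A → Unfolding Θ σ A
unfold-bisim Θ σ (unfoldˡ θ e p) = unf c-lbisim θ e p
unfold-bisim Θ σ (unfoldᵉ θ e p) = unf c-ebisim θ e p

unfold : (Θ σ : Ctx) (A : Atom (Θ ++ σ)) → True Bisim Θ σ A → Unfolding Θ σ A
unfold Θ σ (one P A Q)  p = unfold-holds Θ σ p
unfold Θ σ (onep P A Q) p = unfold-holds Θ σ p
unfold Θ σ (eq τ t u)   p = unfold-holds Θ σ p
unfold Θ σ (lbisim P Q) p = unfold-bisim Θ σ p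
unfold Θ σ (ebisim P Q) p = unfold-bisim Θ σ p

-- Soundness

Force : Sub Θ Θ' → GJ Θ → Set
Force {Θ' = Θ'} r (σ ▹ B) = Forces Θ' σ (liftS* σ r) B

force-mono : (r : Sub Θ Θ') (r' : Sub Θ' Ψ) {J : GJ Θ} → Force r J → Force (r' ∘ₛ r) J
force-mono {Ψ = Ψ} r r' {σ ▹ B} p = forces-≈ B Ψ σ _ _
  (≡⇒≈ₛ (liftS* σ r' ∘ₛ liftS* σ r) _ (lift*-∘ σ r' r (r' ∘ₛ r) (λ _ → refl)))
  (forces-mono B σ r' (liftS* σ r) p)

lift*-∘-≈ : (σ : Ctx) (s : Sub Δ Θ) (u : Sub Γ Δ) (v : Sub Γ Θ) → (s ∘ₛ u) ≈ₛ v →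
            (liftS* σ s ∘ₛ liftS* σ u) ≈ₛ liftS* σ v
lift*-∘-≈ σ s u v e x = ≈trans (≡⇒≈ (lift*-∘ σ s u (s ∘ₛ u) (λ _ → refl) x)) (lift*-≈ σ (s ∘ₛ u) v e x)

force-sub⁻ : (s : Sub Θ' Ψ) (u : Sub Θ Θ') (v : Sub Θ Ψ) → (s ∘ₛ u) ≈ₛ v →
             {J : GJ Θ} → Force s (subGJ u J) → Force v J
force-sub⁻ {Ψ = Ψ} s u v e {σ ▹ B} = forces-sub⁻ B Ψ σ _ _ _ (lift*-∘-≈ σ s u v e)

force-sub⁺ : (s : Sub Θ' Ψ) (u : Sub Θ Θ') (v : Sub Θ Ψ) → (s ∘ₛ u) ≈ₛ v →
             {J : GJ Θ} → Force v J → Force s (subGJ u J)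
force-sub⁺ {Ψ = Ψ} s u v e {σ ▹ B} = forces-sub⁺ B Ψ σ _ _ _ (lift*-∘-≈ σ s u v e)

lift*-liftR* : (σ : Ctx) (s : Sub Δ Θ) (ρ : Ren Γ Δ) (v : Sub Γ Θ) → (∀ {τ} (x : Γ ∋ τ) → s (ρ x) ≡ v x) →
               (λ {τ} (x : Γ ++ σ ∋ τ) → liftS* σ s (liftR* σ ρ x)) ≗ₛ liftS* σ v
lift*-liftR* σ s ρ v e x = trans (cong (sub (liftS* σ s)) (sym (lift*-ren σ ρ x)))
                                 (lift*-∘ σ s (renS ρ) v e x)

-- This connects the two readings of a quantifier under `σ`: in the model it ranges over terms that
-- may use `σ`, in the calculus it introduces a raised variable applied to `σ`.
raise-≈ : (σ : Ctx) (r : Sub Θ Θ') (t : Tm (Θ' ++ σ) τ) →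
          (liftS* σ (r ▸ lamAll σ t) ∘ₛ raiseSub σ) ≈ₛ (liftS* σ r ▸ t)
raise-≈ σ r t here      = ≈trans (≡⇒≈ (sub-appAll σ (r ▸ lamAll σ t) (var here))) (appAll-lamAll σ t)
raise-≈ σ r t (there x) = ≡⇒≈ (lift*-liftR* σ (r ▸ lamAll σ t) there r (λ _ → refl) x)

sub0-≈ : (s : Sub Γ Δ) (t : Tm Γ τ) → (s ∘ₛ sub0 t) ≈ₛ (s ▸ sub s t)
sub0-≈ s t here      = ≈refl
sub0-≈ s t (there x) = ≈refl

lift*-id-∘ : (σ : Ctx) (s : Sub Γ (Θ ++ σ)) → (liftS* σ var ∘ₛ s) ≈ₛ s
lift*-id-∘ σ s x = ≡⇒≈ (sub-id (liftS* σ var) (lift*-id σ var (λ _ → refl)) (s x))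

∘-clauseSub : (Θ : Ctx) (σ : Ctx) (s : Sub (Θ ++ raise* σ Δ) Ψ) (θ : Sub Δ (Ψ ++ σ)) →
              (∀ {τ} (x : Δ ∋ τ) → s (inR {Γ = Θ} (raiseVar {σ = σ} x)) ≡ lamAll σ (θ x)) →
              (liftS* σ s ∘ₛ clauseSub {Θ = Θ} σ) ≈ₛ θ
∘-clauseSub Θ σ s θ e x = ≈trans
  (≡⇒≈ (trans (sub-appAll σ s (var (inR {Γ = Θ} (raiseVar x)))) (cong (appAll σ) (e x))))
  (appAll-lamAll σ (θ x))

pair : (Δ σ : Ctx) → Sub Θ Ψ → Sub Δ (Ψ ++ σ) → Sub (Θ ++ raise* σ Δ) Ψ
pair ε       σ r θ = r
pair (Δ , τ) σ r θ = pair Δ σ r (λ x → θ (there x)) ▸ lamAll σ (θ here)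

pair-inL : (Δ σ : Ctx) (r : Sub Θ Ψ) (θ : Sub Δ (Ψ ++ σ)) {τ : Ty} (x : Θ ∋ τ) →
           pair Δ σ r θ (inL {Δ = raise* σ Δ} x) ≡ r x
pair-inL ε       σ r θ x = refl
pair-inL (Δ , τ) σ r θ x = pair-inL Δ σ r (λ y → θ (there y)) x

pair-inR : (Δ σ : Ctx) (r : Sub Θ Ψ) (θ : Sub Δ (Ψ ++ σ)) {τ : Ty} (x : Δ ∋ τ) →
           pair Δ σ r θ (inR {Γ = Θ} (raiseVar {σ = σ} x)) ≡ lamAll σ (θ x)
pair-inR (Δ , τ) σ r θ here      = refl
pair-inR (Δ , τ) σ r θ (there x) = pair-inR Δ σ r (λ y → θ (there y)) x

-- A reason for truth becomes a solution of the unification problem: `r` gives the values of the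
-- eigenvariables, and the abstracted clause instance gives those of the raised clause variables.
unfolding-unifier : {Θ Ψ : Ctx} (σ : Ctx) (A : Atom (Θ ++ σ)) (c : Clause) (r : Sub Θ Ψ) (θ : Sub (ctx c) (Ψ ++ σ)) →
                    subA (liftS* σ r) A ≈A subA θ (head c) →
                    Unifier Ξ[ Θ , σ , c ] σ (liftedAtom σ c A) (raisedHead σ c)
unfolding-unifier {Θ} {Ψ} σ A c r θ e = record
  { target  = Ψ
  ; θ       = pair (ctx c) σ r θ
  ; unifies = ≈A-trans
      (≡⇒≈A (subA-sub (liftS* σ (pair (ctx c) σ r θ)) (renS (liftR* σ inL)) (liftS* σ r)
        (lift*-liftR* σ (pair (ctx c) σ r θ) inL r (pair-inL (ctx c) σ r θ)) A))
      (≈A-trans e (≈A-sym (≈A-trans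
        (≡⇒≈A (subA-sub (liftS* σ (pair (ctx c) σ r θ)) (clauseSub {Θ = Θ} σ)
                (liftS* σ (pair (ctx c) σ r θ) ∘ₛ clauseSub {Θ = Θ} σ) (λ _ → refl) (head c)))
        (subA-≈ₛ (liftS* σ (pair (ctx c) σ r θ) ∘ₛ clauseSub {Θ = Θ} σ) θ
          (∘-clauseSub Θ σ (pair (ctx c) σ r θ) θ (pair-inR (ctx c) σ r θ)) (head c)))))
  }

soundness : {Γ : List (GJ Θ)} {C : GJ Θ} → Θ ⨾ Γ ⊢ C → {Θ' : Ctx} (r : Sub Θ Θ') →
            All (Force r) Γ → Force r C
soundness (init {σ = σ} e) {Θ'} r (p ∷ _) = forces-≈F Θ' σ (liftS* σ r) e p
soundness (cut d e) r ps = soundness e r (soundness d r ps ∷ ps)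
soundness (exch π d) r ps = soundness d r (All-resp-↭ (↭-sym π) ps)
soundness (wL d) r (_ ∷ ps) = soundness d r ps
soundness (cL d) r (p ∷ ps) = soundness d r (p ∷ p ∷ ps)
soundness ⊥L r (() ∷ _)
soundness ⊤R r ps = tt
soundness (∧L₁ d) r ((p & _) ∷ ps) = soundness d r (p ∷ ps)
soundness (∧L₂ d) r ((_ & q) ∷ ps) = soundness d r (q ∷ ps)
soundness (∧R d e) r ps = soundness d r ps & soundness e r ps
soundness (∨L d e) r (inj₁ p ∷ ps) = soundness d r (p ∷ ps)
soundness (∨L d e) r (inj₂ q ∷ ps) = soundness e r (q ∷ ps)
soundness (∨R₁ d) r ps = inj₁ (soundness d r ps)
soundness (∨R₂ d) r ps = inj₂ (soundness d r ps)
soundness (⊃L {σ = σ} {A} {B} d e) {Θ'} r (f ∷ ps) = soundness e r (forces-≈ B Θ' σ _ _ id-∘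
    (f var (forces-≈ A Θ' σ _ _ (≈ₛ-sym (liftS* σ var ∘ₛ liftS* σ r) _ id-∘) (soundness d r ps))) ∷ ps)
  where
  id-∘ : (liftS* σ var ∘ₛ liftS* σ r) ≈ₛ liftS* σ r
  id-∘ = lift*-id-∘ σ (liftS* σ r)
soundness (⊃R {σ = σ} {A} {B} d) r ps {Θ''} r' a =
  forces-≈ B Θ'' σ _ _ (≈ₛ-sym s₁ s₂ e)
    (soundness d (r' ∘ₛ r) (forces-≈ A Θ'' σ _ _ e a ∷ All.map (λ {J} → force-mono r r' {J}) ps))
  where
  s₁ = liftS* σ r' ∘ₛ liftS* σ r
  s₂ = liftS* σ (r' ∘ₛ r)
  e  : s₁ ≈ₛ s₂
  e  = ≡⇒≈ₛ s₁ s₂ (lift*-∘ σ r' r (r' ∘ₛ r) (λ _ → refl))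
soundness (∀L {σ = σ} {B = B} t d) {Θ'} r (f ∷ ps) = soundness d r
  (forces-sub⁺ B Θ' σ _ _ _ (sub0-≈ (liftS* σ r) t)
    (forces-≈ B Θ' σ _ _ (▸-≈ (liftS* σ var ∘ₛ liftS* σ r) _ (lift*-id-∘ σ (liftS* σ r)))
      (f var (sub (liftS* σ r) t))) ∷ ps)
soundness (∀R {σ = σ} {B = B} d) r ps {Θ''} r' t =
  forces-≈ B Θ'' σ _ _ (▸-≈ s₂ s₁ (≈ₛ-sym s₁ s₂ e))
    (forces-sub⁻ B Θ'' σ _ _ _ (raise-≈ σ (r' ∘ₛ r) t)
      (soundness d ((r' ∘ₛ r) ▸ lamAll σ t)
        (All.map⁺ (All.map (λ {J} p → force-sub⁺ ((r' ∘ₛ r) ▸ lamAll σ t) wkS (r' ∘ₛ r) (λ _ → ≈refl) {J}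
                                        (force-mono r r' {J} p)) ps))))
  where
  s₁ = liftS* σ r' ∘ₛ liftS* σ r
  s₂ = liftS* σ (r' ∘ₛ r)
  e  : s₁ ≈ₛ s₂
  e  = ≡⇒≈ₛ s₁ s₂ (lift*-∘ σ r' r (r' ∘ₛ r) (λ _ → refl))
soundness (∃L {σ = σ} {B = B} {C} d) {Θ'} r ((t & p) ∷ ps) =
  force-sub⁻ (r ▸ lamAll σ t) wkS r (λ _ → ≈refl) {C}
    (soundness d (r ▸ lamAll σ t)
      (forces-sub⁺ B Θ' σ _ _ _ (raise-≈ σ r t) p ∷
       All.map⁺ (All.map (λ {J} → force-sub⁺ (r ▸ lamAll σ t) wkS r (λ _ → ≈refl) {J}) ps)))
soundness (∃R {σ = σ} {B = B} t d) {Θ'} r ps =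
  sub (liftS* σ r) t & forces-sub⁻ B Θ' σ _ _ _ (sub0-≈ (liftS* σ r) t) (soundness d r ps)
soundness (∇L d) r (p ∷ ps) = soundness d r (p ∷ ps)
soundness (∇R d) r ps = soundness d r ps
soundness (defR {σ = σ} c d θ e D) {Θ'} r ps = true-≈ Θ' σ
  (≈A-sym (≈A-trans (subA-≈ (liftS* σ r) e)
                    (≡⇒≈A (subA-sub (liftS* σ r) θ (liftS* σ r ∘ₛ θ) (λ _ → refl) (head c)))))
  (fold d Θ' σ (liftS* σ r ∘ₛ θ) (forces-sub⁻ (body c) Θ' σ _ _ _ (λ _ → ≈refl) (soundness D r ps)))
-- The clause that makes this instance of the atom true yields a unifier. The given complete set has
-- a member `i` through which it factors, and the premise for `i` is used at the factor `δ` instead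
-- of `r`.
soundness {Θ} (defL {σ = σ} {A} {C} U D) {Θ'} r (p ∷ ps) with unfold Θ' σ (subA (liftS* σ r) A) p
... | unf {c} d θ' e q with complete (U c d) (unfolding-unifier σ A c r θ' e)
...   | i & δ & factor =
  force-sub⁻ δ (restr σ c θᵢ) r restricts {C}
    (soundness (D c d i) δ
      (forces-sub⁺ (subF (clauseSub {Θ = Θ} σ) (body c)) Θ' σ _ _ (liftS* σ (δ ∘ₛ θᵢ)) (lift*-∘-≈ σ δ θᵢ _ (λ _ → ≈refl))
        (forces-sub⁺ (body c) Θ' σ _ _ _ instantiates q) ∷
       All.map⁺ (All.map (λ {J} → force-sub⁺ δ (restr σ c θᵢ) r restricts {J}) ps)))
  where
  θᵢ : Sub Ξ[ Θ , σ , c ] _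
  θᵢ = Unifier.θ (member (U c d) i)
  restricts : (δ ∘ₛ restr σ c θᵢ) ≈ₛ r
  restricts x = ≈trans (≈sym (factor (inL x))) (≡⇒≈ (pair-inL (ctx c) σ r θ' x))
  instantiates : (liftS* σ (δ ∘ₛ θᵢ) ∘ₛ clauseSub {Θ = Θ} σ) ≈ₛ θ'
  instantiates x = ≈trans
    (sub-≈ₛ (liftS* σ (δ ∘ₛ θᵢ)) (liftS* σ (pair (ctx c) σ r θ'))
      (lift*-≈ σ (δ ∘ₛ θᵢ) (pair (ctx c) σ r θ') (λ y → ≈sym (factor y)))
      (clauseSub {Θ = Θ} σ x))
    (∘-clauseSub Θ σ (pair (ctx c) σ r θ') θ' (pair-inR (ctx c) σ r θ') x)

-- Transitions invent no names

pattern x₀ = here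
pattern x₁ = there x₀
pattern x₂ = there x₁
pattern x₃ = there x₂

con₁-inj : Base τ → (c : Const (α ⇒ τ)) {t t' : Tm Γ α} → con c · t ≈ con c · t' → t ≈ t'
con₁-inj b c e with rigid-inj b (app (con c)) (app (con c)) e
... | app _ p = p

con₂-inj : {α₁ α₂ : Ty} → Base τ → (c : Const (α₁ ⇒ α₂ ⇒ τ)) {t t' : Tm Γ α₁} {u u' : Tm Γ α₂} →
           con c · t · u ≈ con c · t' · u' → t ≈ t' × u ≈ u'
con₂-inj b c e with rigid-inj b (app (app (con c))) (app (app (con c))) e
... | app (app _ p) q = p & q

con₃-inj : {α₁ α₂ α₃ : Ty} → Base τ → (c : Const (α₁ ⇒ α₂ ⇒ α₃ ⇒ τ))
           {t t' : Tm Γ α₁} {u u' : Tm Γ α₂} {v v' : Tm Γ α₃} →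
           con c · t · u · v ≈ con c · t' · u' · v' → t ≈ t' × u ≈ u' × v ≈ v'
con₃-inj b c e with rigid-inj b (app (app (app (con c)))) (app (app (app (con c)))) e
... | app (app (app _ p) q) r = p & q & r

↑-inj : Tm Γ α → {t u : Tm Γ τ} → ↑ {α = α} t ≈ ↑ u → t ≈ u
↑-inj n {t} {u} e = subst₂ _≈_ (cancel t) (cancel u) (sub-≈ (sub0 n) e)
  where
  cancel : ∀ t → sub (sub0 n) (↑ t) ≡ t
  cancel t = trans (sub-↑ (sub0 n) t) (sub-id var (λ _ → refl) t)

-- A semantic substitute for a condition on the variables of `t`: occurrences are not invariant
-- under conversion, whereas this is. Taking `u` to be the identity and `s` to move a single
-- variable expresses independence of that variable.
Agree : Sub Γ Δ → Sub Γ Δ → Tm Γ τ → Set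
Agree s u t = sub s t ≈ sub u t

agree-≈ : (s u : Sub Γ Δ) {t t' : Tm Γ τ} → t ≈ t' → Agree s u t → Agree s u t'
agree-≈ s u e a = ≈trans (≈sym (sub-≈ s e)) (≈trans a (sub-≈ u e))

agree-↑ : (s u : Sub Γ Δ) (t : Tm Γ τ) → Agree s u t → Agree (liftS {α = α} s) (liftS u) (↑ t)
agree-↑ s u t a = ≈trans (≡⇒≈ (sub-lift-↑ s t)) (≈trans (ren-≈ there a) (≡⇒≈ (sym (sub-lift-↑ u t))))

agree-↑⁻ : (s u : Sub Γ Δ) (t : Tm Γ τ) → Tm Δ α → Agree (liftS {α = α} s) (liftS u) (↑ t) → Agree s u t
agree-↑⁻ s u t n a = ↑-inj n (≈trans (≡⇒≈ (sym (sub-lift-↑ s t))) (≈trans a (≡⇒≈ (sub-lift-↑ u t))))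

agree-η : (s u : Sub Γ Δ) (M : Tm Γ (α ⇒ τ)) → Agree s u M → Agree (liftS s) (liftS u) (↑ M · v0)
agree-η s u M a = app≈ (agree-↑ s u M a) ≈refl

agree-η⁻ : (s u : Sub Γ Δ) (M : Tm Γ (α ⇒ τ)) → Agree (liftS s) (liftS u) (↑ M · v0) → Agree s u M
agree-η⁻ s u M a = agree-≈ s u (≈sym (η M)) (lam≈ a)

-- The inhabitant of tn lets us strengthen: tn has no closed terms.
one-agree : (s u : Sub Γ Δ) → Tm Δ tn → {P R : Tm Γ tp} {A : Tm Γ ta} → Holds (one P A R) →
            Agree s u P → Agree s u A × Agree s u R
onep-agree : (s u : Sub Γ Δ) → Tm Δ tn → {P : Tm Γ tp} {A : Tm Γ (tn ⇒ ta)} {R : Tm Γ (tn ⇒ tp)} →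
             Holds (onep P A R) → Agree s u P → Agree s u A × Agree s u R
one-agree s u n (def (clause _ (one _ _ _) _) d θ (one≈ eP eA eR) p) a with from d θ p (agree-≈ s u eP a)
  where
  from : ∀ {Δ' P A R B} → Dπ (clause Δ' (one P A R) B) → (θ : Sub Δ' _) → Goal Holds θ B →
         Agree s u (sub θ P) → Agree s u (sub θ A) × Agree s u (sub θ R)
  from c-tau θ p a = ≈refl & con₁-inj tp tauC a
  from c-out θ p a with con₃-inj tp outC a
  ... | x & y & q = app≈ (app≈ ≈refl x) y & q
  from c-match θ p a with con₃-inj tp matchC a
  ... | _ & _ & q = one-agree s u n p q
  from c-sumL θ p a = one-agree s u n p (proj₁ (con₂-inj tp plusC a))
  from c-sumR θ p a = one-agree s u n p (proj₂ (con₂-inj tp plusC a))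
  from c-parL θ p a with con₂-inj tp parC a
  ... | q₁ & q₂ with one-agree s u n p q₁
  ...   | x & y = x & app≈ (app≈ ≈refl y) q₂
  from c-parR θ p a with con₂-inj tp parC a
  ... | q₁ & q₂ with one-agree s u n p q₂
  ...   | x & y = x & app≈ (app≈ ≈refl q₁) y
  -- Both lifts fix the restricted name, so agreement passes under ∇. The action comes back
  -- weakened, and substituting `n` for the restricted name removes the weakening.
  from c-res θ p a with one-agree (liftS s) (liftS u) v0 p
                          (agree-η s u (θ x₂) (agree-≈ s u (≈sym (η (θ x₂))) (con₁-inj tp nuC a)))
  ... | x & y = agree-↑⁻ s u (θ x₁) n x & app≈ ≈refl (lam≈ y)
  from c-close₁ θ (_ & p & q) a with con₂-inj tp parC a
  ... | q₁ & q₂ = ≈refl & app≈ ≈refl (lam≈ (app≈ (app≈ ≈refl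
        (agree-η s u (θ x₁) (proj₂ (onep-agree s u n p q₁)))) (agree-η s u (θ x₀) (proj₂ (onep-agree s u n q q₂)))))
  from c-close₂ θ (_ & p & q) a with con₂-inj tp parC a
  ... | q₁ & q₂ = ≈refl & app≈ ≈refl (lam≈ (app≈ (app≈ ≈refl
        (agree-η s u (θ x₁) (proj₂ (onep-agree s u n p q₁)))) (agree-η s u (θ x₀) (proj₂ (onep-agree s u n q q₂)))))
  -- The transmitted name is visible in the output action. This is why agreement of the action is
  -- part of the conclusion: it controls the name inserted into the residual.
  from c-com₁ θ (_ & p & q) a with con₂-inj tp parC a
  ... | q₁ & q₂ with onep-agree s u n p q₁ | one-agree s u n q q₂
  ...   | _ & m | x & y = ≈refl & app≈ (app≈ ≈refl (app≈ m (proj₂ (con₂-inj ta upC x)))) y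
  from c-com₂ θ (_ & p & q) a with con₂-inj tp parC a
  ... | q₁ & q₂ with one-agree s u n p q₁ | onep-agree s u n q q₂
  ...   | x & y | _ & m = ≈refl & app≈ (app≈ ≈refl y) (app≈ m (proj₂ (con₂-inj ta upC x)))
... | x & y = agree-≈ s u (≈sym eA) x & agree-≈ s u (≈sym eR) y
one-agree s u n (def (clause _ (onep _ _ _) _) d θ () p) a
one-agree s u n (def (clause _ (lbisim _ _) _) d θ () p) a
one-agree s u n (def (clause _ (ebisim _ _) _) d θ () p) a
one-agree s u n (def (clause _ (eq _ _ _) _) d θ () p) a
onep-agree s u n (def (clause _ (onep _ _ _) _) d θ (onep≈ eP eA eR) p) a with from d θ p (agree-≈ s u eP a)
  where
  from : ∀ {Δ' P A R B} → Dπ (clause Δ' (onep P A R) B) → (θ : Sub Δ' _) → Goal Holds θ B →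
         Agree s u (sub θ P) → Agree s u (sub θ A) × Agree s u (sub θ R)
  from c-in θ p a with con₂-inj tp inC a
  ... | x & m = app≈ ≈refl x & m
  from c-matchp θ p a with con₃-inj tp matchC a
  ... | _ & _ & q = onep-agree s u n p q
  from c-sumLp θ p a = onep-agree s u n p (proj₁ (con₂-inj tp plusC a))
  from c-sumRp θ p a = onep-agree s u n p (proj₂ (con₂-inj tp plusC a))
  from c-parLp θ p a with con₂-inj tp parC a
  ... | q₁ & q₂ with onep-agree s u n p q₁
  ...   | x & y = x & lam≈ (app≈ (app≈ ≈refl (agree-η s u (θ x₀) y)) (agree-↑ s u (θ x₂) q₂))
  from c-parRp θ p a with con₂-inj tp parC a
  ... | q₁ & q₂ with onep-agree s u n p q₂
  ...   | x & y = x & lam≈ (app≈ (app≈ ≈refl (agree-↑ s u (θ x₃) q₁)) (agree-η s u (θ x₀) y))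
  from c-resp θ p a with onep-agree (liftS s) (liftS u) v0 p
                           (agree-η s u (θ x₂) (agree-≈ s u (≈sym (η (θ x₂))) (con₁-inj tp nuC a)))
  ... | x & y = agree-↑⁻ s u (θ x₁) n x & lam≈ (app≈ ≈refl (lam≈ (app≈ (app≈
                  (agree-↑ (liftS s) (liftS u) (↑ (θ x₀)) (agree-↑ s u (θ x₀) (agree-η⁻ s u (θ x₀) y))) ≈refl) ≈refl)))
  from c-open θ p a with one-agree (liftS s) (liftS u) v0 p
                           (agree-η s u (θ x₂) (agree-≈ s u (≈sym (η (θ x₂))) (con₁-inj tp nuC a)))
  ... | x & y = app≈ ≈refl (agree-↑⁻ s u (θ x₁) n (proj₁ (con₂-inj ta upC x))) & agree-η⁻ s u (θ x₀) y
... | x & y = agree-≈ s u (≈sym eA) x & agree-≈ s u (≈sym eR) y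
onep-agree s u n (def (clause _ (one _ _ _) _) d θ () p) a
onep-agree s u n (def (clause _ (lbisim _ _) _) d θ () p) a
onep-agree s u n (def (clause _ (ebisim _ _) _) d θ () p) a
onep-agree s u n (def (clause _ (eq _ _ _) _) d θ () p) a

-- Late and early bisimilarity coincide in the model

-- This and the next three types are, by computation, what forcing demands of the consequents in the
-- conjuncts of a bisimilarity body.
FreeMatch : Rel → (Θ σ : Ctx) → Tm (Θ ++ σ) tp → Tm (Θ ++ σ) ta → Tm (Θ ++ σ) tp → Set
FreeMatch R Θ σ Q A P' = Σ _ λ Q' → Holds (one Q A Q') × Bisim Θ σ (R P' Q')

LateMatch EarlyMatch OutMatch : Rel → (Θ σ : Ctx) → Tm (Θ ++ σ) tp → Tm (Θ ++ σ) tn → Tm (Θ ++ σ) (tn ⇒ tp) → Set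
LateMatch R Θ σ Q X P' = Σ _ λ Q' → Holds (onep Q (↓ X) Q') ×
  (∀ {Θ'} (r : Sub Θ Θ') (w : Tm (Θ' ++ σ) tn) →
     Bisim Θ' σ (R (sub (liftS* σ r) P' · w) (sub (liftS* σ r) Q' · w)))
EarlyMatch R Θ σ Q X P' = ∀ {Θ'} (r : Sub Θ Θ') (w : Tm (Θ' ++ σ) tn) →
  Σ _ λ Q' → Holds (onep (sub (liftS* σ r) Q) (↓ (sub (liftS* σ r) X)) Q') ×
             Bisim Θ' σ (R (sub (liftS* σ r) P' · w) (Q' · w))
OutMatch R Θ σ Q X P' = Σ _ λ Q' → Holds (onep Q (↑ₐ X) Q') × Bisim Θ (σ , tn) (R (↑ P' · v0) (↑ Q' · v0))

-- Transitions are stable under substitution, so a late answer can be carried to any later stage and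
-- offered there as the early answer. The recursion descends along the inductive structure of
-- `Bisim`.
lbisim⇒ebisim : (Θ σ : Ctx) {P Q : Tm (Θ ++ σ) tp} → Bisim Θ σ (lbisim P Q) → Bisim Θ σ (ebisim P Q)
lbisim⇒ebisim Θ σ (unfoldᵉ θ () p)
lbisim⇒ebisim Θ σ (unfoldˡ θ (lbisim≈ eP eQ) ((f & i & o) & (f' & i' & o'))) =
  unfoldᵉ θ (ebisim≈ eP eQ)
    (((λ r A r' P' r'' h → free (f r A r' P' r'' h)) &
      (λ r X r' P' r'' h → input (sub (liftS* σ r'') P') (i r X r' P' r'' h)) &
      (λ r X r' P' r'' h → output (o r X r' P' r'' h))) &
     ((λ r A r' P' r'' h → free (f' r A r' P' r'' h)) &
      (λ r X r' P' r'' h → input (sub (liftS* σ r'') P') (i' r X r' P' r'' h)) &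
      (λ r X r' P' r'' h → output (o' r X r' P' r'' h))))
  where
  free : ∀ {Θ Q A P'} → FreeMatch lbisim Θ σ Q A P' → FreeMatch ebisim Θ σ Q A P'
  free (Q' & h & b) = Q' & h & lbisim⇒ebisim _ σ b
  input : ∀ {Θ Q X} P' → LateMatch lbisim Θ σ Q X P' → EarlyMatch ebisim Θ σ Q X P'
  input P' (Q' & h & b) r w = sub (liftS* σ r) Q' & holds-sub (liftS* σ r) h & lbisim⇒ebisim _ σ (b r w)
  output : ∀ {Θ Q X P'} → OutMatch lbisim Θ σ Q X P' → OutMatch ebisim Θ σ Q X P'
  output (Q' & h & b) = Q' & h & lbisim⇒ebisim _ (σ , tn) b

-- The answer Q″ to a fresh name h σ does not mention h, because Q does not: so it is the
-- weakening of a late answer, and substituting for h gives bisimilarity at every name.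
early⇒late : ∀ {Θ σ Q X P' Q″} →
             Holds (onep (sub (liftS* σ wkS) Q) (↓ (sub (liftS* σ wkS) X)) Q″) →
             Bisim (Θ , raise σ tn) σ (lbisim (sub (liftS* σ wkS) P' · appAll σ v0) (Q″ · appAll σ v0)) →
             LateMatch lbisim Θ σ Q X P'
early⇒late {Θ} {σ} {Q} {X} {P'} {Q″} h b =
  sub c Q″ & holds-≈ (onep≈ (≡⇒≈ (closing Q)) (app≈ ≈refl (≡⇒≈ (closing X))) ≈refl) (holds-sub c h) &
  λ {Θ'} r t → bisim-≈ {Θ = Θ'} {σ} (lbisim≈
      (app≈ (≡⇒≈ (instantiate r t P')) (new r t))
      (app≈ (≈trans (sub-≈ (inst r t) (≈sym weakening)) (≡⇒≈ (instantiate r t (sub c Q″)))) (new r t)))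
    (bisim-mono σ (r ▸ lamAll σ t) b)
  where
  w : Sub (Θ ++ σ) ((Θ , raise σ tn) ++ σ)
  w = liftS* σ wkS
  inst : ∀ {Θ'} → Sub Θ Θ' → Tm (Θ' ++ σ) tn → Sub ((Θ , raise σ tn) ++ σ) (Θ' ++ σ)
  inst r t = liftS* σ (r ▸ lamAll σ t)
  c : Sub ((Θ , raise σ tn) ++ σ) (Θ ++ σ)
  -- The fresh name is closed off by `X` because this is a name known to exist at the current stage;
  -- its identity does not matter.
  c = inst var X
  instantiate : ∀ {Θ' τ} (r : Sub Θ Θ') (t : Tm (Θ' ++ σ) tn) (u : Tm (Θ ++ σ) τ) →
                sub (inst r t) (sub w u) ≡ sub (liftS* σ r) u
  instantiate r t u = sub-sub (inst r t) w (liftS* σ r)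
    (lift*-∘ σ (r ▸ lamAll σ t) wkS r (λ _ → refl)) u
  closing : ∀ {τ} (u : Tm (Θ ++ σ) τ) → sub c (sub w u) ≡ u
  closing u = trans (instantiate var X u) (sub-id (liftS* σ var) (lift*-id σ var (λ _ → refl)) u)
  new : ∀ {Θ'} (r : Sub Θ Θ') (t : Tm (Θ' ++ σ) tn) → sub (inst r t) (appAll σ v0) ≈ t
  new r t = ≈trans (≡⇒≈ (sub-appAll σ (r ▸ lamAll σ t) v0)) (appAll-lamAll σ t)
  -- `w ∘ₛ c` moves only the fresh name, so it agrees with the identity on `sub w Q`; `onep-agree`
  -- extends the agreement to the answer.
  weakening : sub w (sub c Q″) ≈ Q″
  weakening = ≈trans (≡⇒≈ (sub-sub w c (w ∘ₛ c) (λ _ → refl) Q″))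
    (≈trans (proj₂ (onep-agree (w ∘ₛ c) var (sub w X) h
        (≡⇒≈ (trans (sym (sub-sub w c (w ∘ₛ c) (λ _ → refl) (sub w Q)))
             (trans (cong (sub w) (closing Q)) (sym (sub-id var (λ _ → refl) (sub w Q))))))))
      (≡⇒≈ (sub-id var (λ _ → refl) Q″)))

ebisim⇒lbisim : (Θ σ : Ctx) {P Q : Tm (Θ ++ σ) tp} → Bisim Θ σ (ebisim P Q) → Bisim Θ σ (lbisim P Q)
ebisim⇒lbisim Θ σ (unfoldˡ θ () p)
ebisim⇒lbisim Θ σ (unfoldᵉ θ (ebisim≈ eP eQ) ((f & i & o) & (f' & i' & o'))) =
  unfoldˡ θ (lbisim≈ eP eQ)
    (((λ r A r' P' r'' h → free (f r A r' P' r'' h)) &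
      -- The early hypothesis is used at one generic name: a new eigenvariable of raised type
      -- applied to `σ`, so that its later values may mention local names.
      (λ r X r' P' r'' h → input (sub (liftS* σ r'') P') (i r X r' P' r'' h wkS (appAll σ v0))) &
      (λ r X r' P' r'' h → output (o r X r' P' r'' h))) &
     ((λ r A r' P' r'' h → free (f' r A r' P' r'' h)) &
      (λ r X r' P' r'' h → input (sub (liftS* σ r'') P') (i' r X r' P' r'' h wkS (appAll σ v0))) &
      (λ r X r' P' r'' h → output (o' r X r' P' r'' h))))
  where
  free : ∀ {Θ Q A P'} → FreeMatch ebisim Θ σ Q A P' → FreeMatch lbisim Θ σ Q A P'
  free (Q' & h & b) = Q' & h & ebisim⇒lbisim _ σ b
  input : ∀ {Θ Q X} P' →
          (Σ _ λ Q' → Holds (onep (sub (liftS* σ wkS) Q) (↓ (sub (liftS* σ wkS) X)) Q') ×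
             Bisim (Θ , raise σ tn) σ (ebisim (sub (liftS* σ wkS) P' · appAll σ v0) (Q' · appAll σ v0))) →
          LateMatch lbisim Θ σ Q X P'
  input {Θ} {Q} {X} P' (Q' & h & b) = early⇒late {Θ} {σ} {Q} {X} {P'} h (ebisim⇒lbisim _ σ b)
  output : ∀ {Θ Q X P'} → OutMatch ebisim Θ σ Q X P' → OutMatch lbisim Θ σ Q X P'
  output (Q' & h & b) = Q' & h & ebisim⇒lbisim _ (σ , tn) b

-- Process terms

-- Inversion is built into the definition: whenever an instance of a process term converts to a
-- constructor application, the arguments are structurally smaller process terms.
data Process {Γ : Ctx} (t : Tm Γ tp) : Set
data Spine {Γ : Ctx} : {τ : Ty} → Tm Γ τ → Set
data Arg {Γ : Ctx} : {τ : Ty} → Tm Γ τ → Set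

data Process {Γ} t where
  process : (∀ {Δ} (r : Sub Γ Δ) {u} → sub r t ≈ u → Rigid u → Spine u) → Process t

data Spine {Γ} where
  con : (c : Const τ) → Spine (con c)
  app : {t : Tm Γ (α ⇒ τ)} {u : Tm Γ α} → Spine t → Arg u → Spine (app t u)

data Arg {Γ} where
  nam  : {x : Tm Γ tn} → Arg x
  proc : {P : Tm Γ tp} → Process P → Arg P
  abs  : {M : Tm Γ (tn ⇒ tp)} → Process (↑ M · v0) → Arg M

process-≈ : {t t' : Tm Γ tp} → t ≈ t' → Process t → Process t'
process-≈ e (process f) = process λ r e' ρ → f r (≈trans (sub-≈ r e) e') ρ

process-sub : (s : Sub Γ Δ) {t : Tm Γ tp} → Process t → Process (sub s t)
process-sub s {t} (process f) = process λ r e ρ →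
  f (r ∘ₛ s) (≈trans (≡⇒≈ (sym (sub-sub r s (r ∘ₛ s) (λ _ → refl) t))) e) ρ

arg-≈ : {t t' : Tm Γ τ} → t ≈ t' → Arg t → Arg t'
arg-≈ e nam      = nam
arg-≈ e (proc p) = proc (process-≈ e p)
arg-≈ e (abs p)  = abs (process-≈ (app≈ (ren-≈ there e) ≈refl) p)

arg-sub : (s : Sub Γ Δ) {t : Tm Γ τ} → Arg t → Arg (sub s t)
arg-sub s nam      = nam
arg-sub s (proc p) = proc (process-sub s p)
arg-sub s (abs {M} p) = abs (process-≈ (app≈ (≡⇒≈ (sub-lift-↑ s M)) ≈refl) (process-sub (liftS s) p))

spine-~ : {t t' : Tm Γ τ} → t ~ t' → Spine t → Spine t'
spine-~ (con c)   (con .c)  = con c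
spine-~ (app n e) (app p a) = app (spine-~ n p) (arg-≈ e a)

spine-sub : (s : Sub Γ Δ) {t : Tm Γ τ} → Spine t → Spine (sub s t)
spine-sub s (con c)   = con c
spine-sub s (app p a) = app (spine-sub s p) (arg-sub s a)

spine-rigid : {t : Tm Γ τ} → Spine t → Rigid t
spine-rigid (con c)   = con c
spine-rigid (app p a) = app (spine-rigid p)

-- An instance of a spine is again a spine, and by `rigid-inj` any rigid term convertible to it has
-- the same head and convertible arguments.
spine⇒process : {t : Tm Γ tp} → Spine t → Process t
spine⇒process p = process λ r e ρ →
  spine-~ (rigid-inj tp (spine-rigid (spine-sub r p)) ρ e) (spine-sub r p)

process⇒spine : {t u : Tm Γ tp} → t ≈ u → Rigid u → Process t → Spine u
process⇒spine {t = t} e ρ (process f) = f var (≈trans (≡⇒≈ (sub-id var (λ _ → refl) t)) e) ρ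

lam-↑ : (t : Tm (Γ , α) τ) → ↑ (lam t) · v0 ≈ t
lam-↑ t = ≈trans (β (ren (liftR there) t) v0)
  (≡⇒≈ (trans (sub-ren (sub0 v0) (liftR there) var (λ { here → refl ; (there _) → refl }) t)
              (sub-id var (λ _ → refl) t)))

abs-lam : {t : Tm (Γ , tn) tp} → Process t → Arg (lam t)
abs-lam {t = t} p = abs (process-≈ (≈sym (lam-↑ t)) p)

process-↑ : {t : Tm Γ tp} → Process t → Process (↑ {α = α} t)
process-↑ {t = t} p = process-≈ (≡⇒≈ (sym (ren-as-sub there t))) (process-sub (renS there) p)

process-app : {M : Tm Γ (tn ⇒ tp)} {x : Tm Γ tn} → Process (↑ M · v0) → Process (M · x)
process-app {M = M} {x} p = process-≈
  (app≈ (≡⇒≈ (trans (sub-↑ (sub0 x) M) (sub-id var (λ _ → refl) M))) ≈refl) (process-sub (sub0 x) p)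

-- For `c-resp`: its ∇ binds the restricted name outside the parameter of the residual, while the
-- new residual binds them in the opposite order.
process-swap : {M : Tm Γ (tn ⇒ tn ⇒ tp)} → Process (↑ (↑ M · v0) · v0) → Process (↑ (↑ M) · v0 · v1)
process-swap {Γ} {M} p = process-≈ (app≈ (app≈ (≡⇒≈ swap-↑↑) ≈refl) ≈refl) (process-sub swap p)
  where
  swap : Sub (Γ , tn , tn) (Γ , tn , tn)
  swap x₀                = v1
  swap x₁                = v0
  swap (there (there x)) = var (there (there x))
  swap-↑↑ : sub swap (↑ (↑ M)) ≡ ↑ (↑ M)
  swap-↑↑ = trans (trans (sub-↑ swap (↑ M)) (sub-↑ (λ x → swap (there x)) M))
    (trans (sym (ren-as-sub (λ x → there (there x)) M))
           (sym (ren-ren there there (λ x → there (there x)) (λ _ → refl) M)))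

⟦⟧-spine : {k : ℕ} (P : Proc k) → Spine ⟦ P ⟧
⟦⟧-process : {k : ℕ} (P : Proc k) → Process ⟦ P ⟧
⟦⟧-process P = spine⇒process (⟦⟧-spine P)
⟦⟧-spine pnil           = con nilC
⟦⟧-spine (psum P Q)     = app (app (con plusC) (proc (⟦⟧-process P))) (proc (⟦⟧-process Q))
⟦⟧-spine (ppar P Q)     = app (app (con parC) (proc (⟦⟧-process P))) (proc (⟦⟧-process Q))
⟦⟧-spine (ptau P)       = app (con tauC) (proc (⟦⟧-process P))
⟦⟧-spine (pmatch x y P) = app (app (app (con matchC) nam) nam) (proc (⟦⟧-process P))
⟦⟧-spine (pout x y P)   = app (app (app (con outC) nam) nam) (proc (⟦⟧-process P))
⟦⟧-spine (pin x P)      = app (app (con inC) nam) (abs-lam (⟦⟧-process P))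
⟦⟧-spine (pres P)       = app (con nuC) (abs-lam (⟦⟧-process P))

-- Bisimilarity continues at residuals, whose transition hypotheses must be eliminable in turn; this
-- keeps the continuation within process terms.
one-process : {P R : Tm Γ tp} {A : Tm Γ ta} → Holds (one P A R) → Process P → Process R
onep-process : {P : Tm Γ tp} {A : Tm Γ (tn ⇒ ta)} {R : Tm Γ (tn ⇒ tp)} → Holds (onep P A R) →
               Process P → Process (↑ R · v0)
one-process {Γ} (def (clause _ (one _ _ _) _) d θ (one≈ eP eA eR) h) p = process-≈ (≈sym eR)
  (from d θ h (λ ρ → process⇒spine eP ρ p))
  where
  from : ∀ {Δ' P A R B} → Dπ (clause Δ' (one P A R) B) → (θ : Sub Δ' Γ) → Goal Holds θ B →
         (Rigid (sub θ P) → Spine (sub θ P)) → Process (sub θ R)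
  from c-tau θ h s with s (app (con tauC))
  ... | app _ (proc q) = q
  from c-out θ h s with s (app (app (app (con outC))))
  ... | app _ (proc q) = q
  from c-match θ h s with s (app (app (app (con matchC))))
  ... | app _ (proc q) = one-process h q
  from c-sumL θ h s with s (app (app (con plusC)))
  ... | app (app _ (proc q)) _ = one-process h q
  from c-sumR θ h s with s (app (app (con plusC)))
  ... | app _ (proc q) = one-process h q
  from c-parL θ h s with s (app (app (con parC)))
  ... | app (app _ (proc q₁)) (proc q₂) = spine⇒process (app (app (con parC) (proc (one-process h q₁))) (proc q₂))
  from c-parR θ h s with s (app (app (con parC)))
  ... | app (app _ (proc q₁)) (proc q₂) = spine⇒process (app (app (con parC) (proc q₁)) (proc (one-process h q₂)))
  from c-res θ h s with s (app (con nuC))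
  ... | app _ (abs q) = spine⇒process (app (con nuC) (abs-lam (one-process h (process-≈ (lam-↑ _) q))))
  from c-close₁ θ (_ & h₁ & h₂) s with s (app (app (con parC)))
  ... | app (app _ (proc q₁)) (proc q₂) = spine⇒process (app (con nuC) (abs-lam (spine⇒process
          (app (app (con parC) (proc (onep-process h₁ q₁))) (proc (onep-process h₂ q₂))))))
  from c-close₂ θ (_ & h₁ & h₂) s with s (app (app (con parC)))
  ... | app (app _ (proc q₁)) (proc q₂) = spine⇒process (app (con nuC) (abs-lam (spine⇒process
          (app (app (con parC) (proc (onep-process h₁ q₁))) (proc (onep-process h₂ q₂))))))
  from c-com₁ θ (_ & h₁ & h₂) s with s (app (app (con parC)))
  ... | app (app _ (proc q₁)) (proc q₂) = spine⇒process
          (app (app (con parC) (proc (process-app (onep-process h₁ q₁)))) (proc (one-process h₂ q₂)))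
  from c-com₂ θ (_ & h₁ & h₂) s with s (app (app (con parC)))
  ... | app (app _ (proc q₁)) (proc q₂) = spine⇒process
          (app (app (con parC) (proc (one-process h₁ q₁))) (proc (process-app (onep-process h₂ q₂))))
one-process (def (clause _ (onep _ _ _) _) d θ () h) p
one-process (def (clause _ (lbisim _ _) _) d θ () h) p
one-process (def (clause _ (ebisim _ _) _) d θ () h) p
one-process (def (clause _ (eq _ _ _) _) d θ () h) p
onep-process {Γ} (def (clause _ (onep _ _ _) _) d θ (onep≈ eP eA eR) h) p =
  process-≈ (app≈ (ren-≈ there (≈sym eR)) ≈refl) (from d θ h (λ ρ → process⇒spine eP ρ p))
  where
  from : ∀ {Δ' P A R B} → Dπ (clause Δ' (onep P A R) B) → (θ : Sub Δ' Γ) → Goal Holds θ B →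
         (Rigid (sub θ P) → Spine (sub θ P)) → Process (↑ (sub θ R) · v0)
  from c-in θ h s with s (app (app (con inC)))
  ... | app _ (abs q) = q
  from c-matchp θ h s with s (app (app (app (con matchC))))
  ... | app _ (proc q) = onep-process h q
  from c-sumLp θ h s with s (app (app (con plusC)))
  ... | app (app _ (proc q)) _ = onep-process h q
  from c-sumRp θ h s with s (app (app (con plusC)))
  ... | app _ (proc q) = onep-process h q
  from c-parLp θ h s with s (app (app (con parC)))
  ... | app (app _ (proc q₁)) (proc q₂) = process-≈ (≈sym (lam-↑ _)) (spine⇒process
          (app (app (con parC) (proc (onep-process h q₁)))
               (proc (process-↑ q₂))))
  from c-parRp θ h s with s (app (app (con parC)))
  ... | app (app _ (proc q₁)) (proc q₂) = process-≈ (≈sym (lam-↑ _)) (spine⇒process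
          (app (app (con parC) (proc (process-↑ q₁))) (proc (onep-process h q₂))))
  from c-resp θ h s with s (app (con nuC))
  ... | app _ (abs q) = process-≈ (≈sym (lam-↑ _)) (spine⇒process (app (con nuC) (abs-lam
          (process-swap (onep-process h (process-≈ (lam-↑ _) q))))))
  from c-open θ h s with s (app (con nuC))
  ... | app _ (abs q) = one-process h (process-≈ (lam-↑ _) q)
onep-process (def (clause _ (one _ _ _) _) d θ () h) p
onep-process (def (clause _ (lbisim _ _) _) d θ () h) p
onep-process (def (clause _ (ebisim _ _) _) d θ () h) p
onep-process (def (clause _ (eq _ _ _) _) d θ () h) p

-- Transition atoms of process terms can be unfolded only finitely often

-- The existential is read universally and at every later context: on the left its witness is an
-- eigenvariable, which later uses of `defL` may instantiate.
WfGoal : (∀ {Γ} → Atom Γ → Set) → Sub Γ Δ → Fm Γ → Set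
WfGoal X s (atom A)  = X (subA s A)
WfGoal X s ⊤ᶠ        = ⊤
WfGoal X s (A ∧ᶠ B)  = WfGoal X s A × WfGoal X s B
WfGoal {Δ = Δ} X s (∃ᶠ τ B) = ∀ {Θ} (r : Sub Δ Θ) (t : Tm Θ τ) → WfGoal X ((r ∘ₛ s) ▸ t) B
WfGoal X s (∇ᶠ τ B)  = WfGoal X (liftS s) B
WfGoal X s ⊥ᶠ        = ⊥
WfGoal X s (A ∨ᶠ B)  = ⊥
WfGoal X s (A ⊃ᶠ B)  = ⊥
WfGoal X s (∀ᶠ τ B)  = ⊥

-- Accessibility under unfolding, for all instances of the atom at once, because a unifier
-- instantiates the atom before the clause body appears.
data Wf {Γ : Ctx} (A : Atom Γ) : Set where
  wf : (∀ {Δ} (r : Sub Γ Δ) (c : Clause) → Dπ c → (θ : Sub (ctx c) Δ) →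
        subA r A ≈A subA θ (head c) → WfGoal Wf θ (body c)) → Wf A

-- Instances are included because the witness of the existential in a communication clause lives in
-- a later context.
WfTransitions : Tm Γ tp → Set
WfTransitions {Γ} P = ∀ {Δ} (r : Sub Γ Δ) {P'} → sub r P ≈ P' →
  (∀ A R → Wf (one P' A R)) × (∀ A R → Wf (onep P' A R))

wfTransitions-≈ : {P P' : Tm Γ tp} → P ≈ P' → WfTransitions P → WfTransitions P'
wfTransitions-≈ e w r e' = w r (≈trans (sub-≈ r e) e')

wf-here : {P : Tm Γ tp} → WfTransitions P → (∀ A R → Wf (one P A R)) × (∀ A R → Wf (onep P A R))
wf-here {P = P} w = w var (≡⇒≈ (sub-id var (λ _ → refl) P))

-- Every clause body speaks of strict subprocesses of the process in its head, and `Process`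
-- provides these. Actions and residuals stay arbitrary, since the process argument alone decreases.
process-wf : {P : Tm Γ tp} → Process P → WfTransitions P
wf-last    : {t : Tm Γ (tp ⇒ tp)} {P : Tm Γ tp} → Spine (t · P) → WfTransitions P
wf-first   : {t : Tm Γ (tp ⇒ tp ⇒ tp)} {P Q : Tm Γ tp} → Spine (t · P · Q) → WfTransitions P
wf-body    : {t : Tm Γ ((tn ⇒ tp) ⇒ tp)} {P : Tm (Γ , tn) tp} → Spine (t · lam P) → WfTransitions P
wf-last  (app _ (proc p))         = process-wf p
wf-first (app (app _ (proc p)) _) = process-wf p
wf-body {P = P} (app _ (abs p))   = wfTransitions-≈ (lam-↑ P) (process-wf p)
process-wf {P = P} (process f) r {P'} e =
    (λ A R → wf λ { r' (clause _ (one _ _ _) _) d θ (one≈ eP _ _) → one-from d θ (r' ∘ₛ r) (instance-≈ r' eP)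
                  ; r' (clause _ (onep _ _ _) _) d θ ()
                  ; r' (clause _ (lbisim _ _) _) d θ ()
                  ; r' (clause _ (ebisim _ _) _) d θ ()
                  ; r' (clause _ (eq _ _ _) _) d θ () })
  & (λ A R → wf λ { r' (clause _ (onep _ _ _) _) d θ (onep≈ eP _ _) → onep-from d θ (r' ∘ₛ r) (instance-≈ r' eP)
                  ; r' (clause _ (one _ _ _) _) d θ ()
                  ; r' (clause _ (lbisim _ _) _) d θ ()
                  ; r' (clause _ (ebisim _ _) _) d θ ()
                  ; r' (clause _ (eq _ _ _) _) d θ () })
  where
  instance-≈ : ∀ {Δ} (r' : Sub _ Δ) {u} → sub r' P' ≈ u → sub (r' ∘ₛ r) P ≈ u
  instance-≈ r' e' = ≈trans (≡⇒≈ (sym (sub-sub r' r (r' ∘ₛ r) (λ _ → refl) P))) (≈trans (sub-≈ r' e) e')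

  one-from : ∀ {Δ Δ' P₀ A R B} → Dπ (clause Δ' (one P₀ A R) B) → (θ : Sub Δ' Δ) (r : Sub _ Δ) →
             sub r P ≈ sub θ P₀ → WfGoal Wf θ B
  one-from c-tau θ r e = tt
  one-from c-out θ r e = tt
  one-from c-match θ r e = proj₁ (wf-here (wf-last (f r e (app (app (app (con matchC))))))) _ _
  one-from c-sumL θ r e = proj₁ (wf-here (wf-first (f r e (app (app (con plusC)))))) _ _
  one-from c-sumR θ r e = proj₁ (wf-here (wf-last (f r e (app (app (con plusC)))))) _ _
  one-from c-parL θ r e = proj₁ (wf-here (wf-first (f r e (app (app (con parC)))))) _ _
  one-from c-parR θ r e = proj₁ (wf-here (wf-last (f r e (app (app (con parC)))))) _ _
  one-from c-res θ r e = proj₁ (wf-here (wf-body (f r e (app (con nuC))))) _ _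
  one-from c-close₁ θ r e r' _ =
    proj₂ (wf-first (f r e (app (app (con parC)))) r' ≈refl) _ _ & proj₂ (wf-last (f r e (app (app (con parC)))) r' ≈refl) _ _
  one-from c-close₂ θ r e r' _ =
    proj₂ (wf-first (f r e (app (app (con parC)))) r' ≈refl) _ _ & proj₂ (wf-last (f r e (app (app (con parC)))) r' ≈refl) _ _
  one-from c-com₁ θ r e r' _ =
    proj₂ (wf-first (f r e (app (app (con parC)))) r' ≈refl) _ _ & proj₁ (wf-last (f r e (app (app (con parC)))) r' ≈refl) _ _
  one-from c-com₂ θ r e r' _ =
    proj₁ (wf-first (f r e (app (app (con parC)))) r' ≈refl) _ _ & proj₂ (wf-last (f r e (app (app (con parC)))) r' ≈refl) _ _

  onep-from : ∀ {Δ Δ' P₀ A R B} → Dπ (clause Δ' (onep P₀ A R) B) → (θ : Sub Δ' Δ) (r : Sub _ Δ) →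
              sub r P ≈ sub θ P₀ → WfGoal Wf θ B
  onep-from c-in θ r e = tt
  onep-from c-matchp θ r e = proj₂ (wf-here (wf-last (f r e (app (app (app (con matchC))))))) _ _
  onep-from c-sumLp θ r e = proj₂ (wf-here (wf-first (f r e (app (app (con plusC)))))) _ _
  onep-from c-sumRp θ r e = proj₂ (wf-here (wf-last (f r e (app (app (con plusC)))))) _ _
  onep-from c-parLp θ r e = proj₂ (wf-here (wf-first (f r e (app (app (con parC)))))) _ _
  onep-from c-parRp θ r e = proj₂ (wf-here (wf-last (f r e (app (app (con parC)))))) _ _
  onep-from c-resp θ r e = proj₂ (wf-here (wf-body (f r e (app (con nuC))))) _ _
  onep-from c-open θ r e = proj₁ (wf-here (wf-body (f r e (app (con nuC))))) _ _

-- Derivations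

subGJ-sub : (s : Sub Θ' Ψ) (u : Sub Θ Θ') (v : Sub Θ Ψ) → s ∘ₛ u ≗ₛ v →
            (J : GJ Θ) → subGJ s (subGJ u J) ≡ subGJ v J
subGJ-sub s u v e (σ ▹ B) = cong (σ ▹_) (subF-sub (liftS* σ s) (liftS* σ u) (liftS* σ v) (lift*-∘ σ s u v e) B)

subCx-sub : (s : Sub Θ' Ψ) (u : Sub Θ Θ') (v : Sub Θ Ψ) → s ∘ₛ u ≗ₛ v →
            (Γ : List (GJ Θ)) → subCx s (subCx u Γ) ≡ subCx v Γ
subCx-sub s u v e []      = refl
subCx-sub s u v e (J ∷ Γ) = cong₂ _∷_ (subGJ-sub s u v e J) (subCx-sub s u v e Γ)

subGJ-id : (J : GJ Θ) → subGJ var J ≡ J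
subGJ-id (σ ▹ B) = cong (σ ▹_) (subF-id (liftS* σ var) (lift*-id σ var (λ _ → refl)) B)

subCx-id : (Γ : List (GJ Θ)) → subCx var Γ ≡ Γ
subCx-id []      = refl
subCx-id (J ∷ Γ) = cong₂ _∷_ (subGJ-id J) (subCx-id Γ)

castˡ : {Γ : List (GJ Θ)} {C : GJ Θ} (σ : Ctx) {A B : Fm (Θ ++ σ)} → A ≡ B →
        Θ ⨾ (σ ▹ B) ∷ Γ ⊢ C → Θ ⨾ (σ ▹ A) ∷ Γ ⊢ C
castˡ σ refl d = d

castʳ : {Γ : List (GJ Θ)} (σ : Ctx) {A B : Fm (Θ ++ σ)} → A ≡ B →
        Θ ⨾ Γ ⊢ σ ▹ B → Θ ⨾ Γ ⊢ σ ▹ A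
castʳ σ refl d = d

holds⇒⊢ : (Θ σ : Ctx) {A : Atom (Θ ++ σ)} {Γ : List (GJ Θ)} → Holds A → Θ ⨾ Γ ⊢ σ ▹ atom A
goal⇒⊢  : (B : Fm Δ) (Θ σ : Ctx) (s : Sub Δ (Θ ++ σ)) {Γ : List (GJ Θ)} → Goal Holds s B →
          Θ ⨾ Γ ⊢ σ ▹ subF s B
holds⇒⊢ Θ σ (def c d θ e p) = defR c d θ e (goal⇒⊢ (body c) Θ σ θ p)
goal⇒⊢ (atom A) Θ σ s p = holds⇒⊢ Θ σ p
goal⇒⊢ ⊤ᶠ       Θ σ s p = ⊤R
goal⇒⊢ (A ∧ᶠ B) Θ σ s (p & q) = ∧R (goal⇒⊢ A Θ σ s p) (goal⇒⊢ B Θ σ s q)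
goal⇒⊢ (∃ᶠ τ B) Θ σ s (t & p) = ∃R t
  (castʳ σ (subF-sub (sub0 t) (liftS s) (s ▸ t) (sub0-lift s t) B) (goal⇒⊢ B Θ σ (s ▸ t) p))
goal⇒⊢ (∇ᶠ τ B) Θ σ s p = ∇R (goal⇒⊢ B Θ (σ , τ) (liftS s) p)

goal-≗ : (B : Fm Γ) (s u : Sub Γ Δ) → s ≗ₛ u → Goal Holds s B → Goal Holds u B
goal-≗ B s u e = goal-sub B var s u (λ x → ≡⇒≈ (trans (sub-id var (λ _ → refl) (s x)) (e x)))

raise-fresh : (σ : Ctx) (s : Sub Γ (Θ ++ σ)) →
              raiseSub {Θ = Θ} {τ = τ} σ ∘ₛ liftS s ≗ₛ ((liftS* σ wkS ∘ₛ s) ▸ appAll σ v0)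
raise-fresh σ s here      = refl
raise-fresh σ s (there x) = trans (sub-↑ (raiseSub σ) (s x))
  (sub-ext (λ y → raiseSub σ (there y)) (liftS* σ wkS) (λ y → sym (lift*-ren σ there y)) (s x))

-- Complete sets of unifiers may be infinite, so no unification algorithm is needed.
allUnifiers : {Ξ σ : Ctx} (A B : Atom (Ξ ++ σ)) → CSU Ξ σ A B
allUnifiers A B = record
  { Idx      = Unifier _ _ A B
  ; member   = λ u → u
  ; complete = λ u → u & var & λ x → ≡⇒≈ (sym (sub-id var (λ _ → refl) (Unifier.θ u x)))
  }

-- Left inversion: since the unfolding of A terminates, it suffices to treat the instances that hold.
-- Termination is recorded for A₀ and transported along s₀, so that the recursion stays structural.
atomL : (Θ σ : Ctx) {A₀ : Atom Δ} {A : Atom (Θ ++ σ)} (s₀ : Sub Δ (Θ ++ σ)) {Γ : List (GJ Θ)} {C : GJ Θ} →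
        subA s₀ A₀ ≈A A → Wf A₀ →
        (∀ {Θ'} (r : Sub Θ Θ') → Holds (subA (liftS* σ r) A) → Θ' ⨾ subCx r Γ ⊢ subGJ r C) →
        Θ ⨾ (σ ▹ atom A) ∷ Γ ⊢ C
goalL : (B : Fm Δ) (Θ σ : Ctx) (s : Sub Δ Ψ) (s₀ : Sub Ψ (Θ ++ σ)) (u : Sub Δ (Θ ++ σ))
        {Γ : List (GJ Θ)} {C : GJ Θ} → (s₀ ∘ₛ s) ≈ₛ u → WfGoal Wf s B →
        (∀ {Θ'} (r : Sub Θ Θ') → Goal Holds (liftS* σ r ∘ₛ u) B → Θ' ⨾ subCx r Γ ⊢ subGJ r C) →
        Θ ⨾ (σ ▹ subF u B) ∷ Γ ⊢ C
atomL Θ σ {A₀} {A} s₀ {Γ} {C} e₀ (wf f) k =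
  defL (λ c d → allUnifiers (liftedAtom σ c A) (raisedHead σ c)) premise
  where
  premise : (c : Clause) (d : Dπ c) (u : Unifier Ξ[ Θ , σ , c ] σ (liftedAtom σ c A) (raisedHead σ c)) →
            target u ⨾ (σ ▹ subF (liftS* σ (Unifier.θ u)) (raisedBody σ c)) ∷ subCx (restr σ c (Unifier.θ u)) Γ
              ⊢ subGJ (restr σ c (Unifier.θ u)) C
  premise c d u =
    castˡ σ (subF-sub (liftS* σ φ) (clauseSub {Θ = Θ} σ) θ' (λ _ → refl) (body c))
      (goalL (body c) (target u) σ θ' var θ' (λ x → ≡⇒≈ (sub-id var (λ _ → refl) (θ' x)))
             (f (liftS* σ ρ ∘ₛ s₀) c d θ' e₁) λ r p →
        subst₂ (_ ⨾_⊢_) (sym (subCx-sub r ρ (r ∘ₛ ρ) (λ _ → refl) Γ)) (sym (subGJ-sub r ρ (r ∘ₛ ρ) (λ _ → refl) C))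
          (k (r ∘ₛ ρ) (def c d (liftS* σ r ∘ₛ θ')
            (≈A-trans (≡⇒≈A (sym (subA-sub (liftS* σ r) (liftS* σ ρ) (liftS* σ (r ∘ₛ ρ))
                                    (lift*-∘ σ r ρ (r ∘ₛ ρ) (λ _ → refl)) A)))
            (≈A-trans (subA-≈ (liftS* σ r) e)
                      (≡⇒≈A (subA-sub (liftS* σ r) θ' (liftS* σ r ∘ₛ θ') (λ _ → refl) (head c)))))
            p)))
    where
    φ : Sub Ξ[ Θ , σ , c ] (target u)
    φ = Unifier.θ u
    ρ : Sub Θ (target u)
    ρ = restr σ c φ
    θ' : Sub (ctx c) (target u ++ σ)
    θ' = liftS* σ φ ∘ₛ clauseSub {Θ = Θ} σ
    e : subA (liftS* σ ρ) A ≈A subA θ' (head c)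
    e = ≈A-trans (≡⇒≈A (sym (subA-sub (liftS* σ φ) (renS (liftR* σ inL)) (liftS* σ ρ)
                               (lift*-liftR* σ φ inL ρ (λ _ → refl)) A)))
        (≈A-trans (unifies u) (≡⇒≈A (subA-sub (liftS* σ φ) (clauseSub {Θ = Θ} σ) θ' (λ _ → refl) (head c))))
    e₁ : subA (liftS* σ ρ ∘ₛ s₀) A₀ ≈A subA θ' (head c)
    e₁ = ≈A-trans (≡⇒≈A (sym (subA-sub (liftS* σ ρ) s₀ (liftS* σ ρ ∘ₛ s₀) (λ _ → refl) A₀)))
         (≈A-trans (subA-≈ (liftS* σ ρ) e₀) e)
goalL (atom A) Θ σ s s₀ u e w k = atomL Θ σ s₀
  (≈A-trans (≡⇒≈A (subA-sub s₀ s (s₀ ∘ₛ s) (λ _ → refl) A)) (subA-≈ₛ (s₀ ∘ₛ s) u e A)) w λ r h →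
  k r (holds-≈ (≡⇒≈A (subA-sub (liftS* σ r) u (liftS* σ r ∘ₛ u) (λ _ → refl) A)) h)
goalL ⊤ᶠ Θ σ s s₀ u {Γ} {C} e w k = wL (subst₂ (Θ ⨾_⊢_) (subCx-id Γ) (subGJ-id C) (k var tt))
-- Treating the first conjunct moves to later stages. The copy kept by contraction is instantiated
-- along, and its termination proof follows by composing `s₀` with the transition.
goalL (A ∧ᶠ B) Θ σ s s₀ u {Γ} {C} e (w & w') k = cL (∧L₁ (goalL A Θ σ s s₀ u e w λ {Θ'} r a → ∧L₂
  (castˡ σ (subF-sub (liftS* σ r) u (liftS* σ r ∘ₛ u) (λ _ → refl) B)
    (goalL B Θ' σ s (liftS* σ r ∘ₛ s₀) (liftS* σ r ∘ₛ u) (∘-assoc-≈ (liftS* σ r) s₀ s u e) w' λ r' b →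
      subst₂ (_ ⨾_⊢_) (sym (subCx-sub r' r (r' ∘ₛ r) (λ _ → refl) Γ)) (sym (subGJ-sub r' r (r' ∘ₛ r) (λ _ → refl) C))
        (k (r' ∘ₛ r)
          (goal-sub A (liftS* σ r') (liftS* σ r ∘ₛ u) (liftS* σ (r' ∘ₛ r) ∘ₛ u)
             (λ x → ≡⇒≈ (sym (lift*-∘-assoc σ r' r u x))) a &
           goal-≗ B (liftS* σ r' ∘ₛ liftS* σ r ∘ₛ u) (liftS* σ (r' ∘ₛ r) ∘ₛ u)
             (λ x → sym (lift*-∘-assoc σ r' r u x)) b))))))
goalL (∃ᶠ τ B) Θ σ s s₀ u {Γ} {C} e w k = ∃L
  (castˡ σ (subF-sub (raiseSub σ) (liftS u) u' (raise-fresh σ u) B)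
    (goalL B (Θ , raise σ τ) σ (((liftS* σ wkS ∘ₛ s₀) ∘ₛ s) ▸ appAll σ v0) var u' e'
           (w (liftS* σ wkS ∘ₛ s₀) (appAll σ v0)) λ r b →
      subst₂ (_ ⨾_⊢_) (sym (subCx-sub r wkS (r ∘ₛ wkS) (λ _ → refl) Γ)) (sym (subGJ-sub r wkS (r ∘ₛ wkS) (λ _ → refl) C))
        (k (r ∘ₛ wkS) (sub (liftS* σ r) (appAll σ v0) &
          goal-≗ B (liftS* σ r ∘ₛ u') ((liftS* σ (r ∘ₛ wkS) ∘ₛ u) ▸ sub (liftS* σ r) (appAll σ v0))
            (λ { here → refl ; (there x) → sym (lift*-∘-assoc σ r wkS u x) }) b))))
  where
  u' : Sub _ ((Θ , raise σ τ) ++ σ)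
  u' = (liftS* σ wkS ∘ₛ u) ▸ appAll σ v0
  e' : (var ∘ₛ (((liftS* σ wkS ∘ₛ s₀) ∘ₛ s) ▸ appAll σ v0)) ≈ₛ u'
  e' here      = ≡⇒≈ (sub-id var (λ _ → refl) (appAll σ v0))
  e' (there x) = ≈trans (≡⇒≈ (sub-id var (λ _ → refl) (sub (liftS* σ wkS ∘ₛ s₀) (s x))))
                        (∘-assoc-≈ (liftS* σ wkS) s₀ s u e x)
goalL (∇ᶠ τ B) Θ σ s s₀ u e w k = ∇L (goalL B Θ (σ , τ) (liftS s) (liftS s₀) (liftS u) (lift-∘-≈ s₀ s u e) w λ r b →
  k r (goal-≗ B (liftS (liftS* σ r) ∘ₛ liftS u) (liftS (liftS* σ r ∘ₛ u)) (lift-∘ (liftS* σ r) u) b))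

-- Forcing with derivability in place of truth for the atoms on the right.
Derivable : (Θ σ : Ctx) → Sub Γ (Θ ++ σ) → Fm Γ → Set₁
Derivable Θ σ s (A ∧ᶠ B) = Derivable Θ σ s A × Derivable Θ σ s B
Derivable Θ σ s (A ⊃ᶠ B) = WfGoal Wf s A × (∀ {Θ'} (r : Sub Θ Θ') → Goal Holds (liftS* σ r ∘ₛ s) A →
                           Derivable Θ' σ (liftS* σ r ∘ₛ s) B)
Derivable Θ σ s (∀ᶠ τ B) = ∀ {Θ'} (r : Sub Θ Θ') (t : Tm (Θ' ++ σ) τ) →
                           Derivable Θ' σ ((liftS* σ r ∘ₛ s) ▸ t) B
Derivable Θ σ s (∃ᶠ τ B) = Σ (Tm (Θ ++ σ) τ) λ t → Derivable Θ σ (s ▸ t) B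
Derivable Θ σ s (∇ᶠ τ B) = Derivable Θ (σ , τ) (liftS s) B
Derivable Θ σ s (atom A) = Θ ⨾ [] ⊢ σ ▹ atom (subA s A)
Derivable Θ σ s ⊤ᶠ       = Θ ⨾ [] ⊢ σ ▹ ⊤ᶠ
Derivable Θ σ s ⊥ᶠ       = Θ ⨾ [] ⊢ σ ▹ ⊥ᶠ
Derivable Θ σ s (A ∨ᶠ B) = Θ ⨾ [] ⊢ σ ▹ subF s (A ∨ᶠ B)

-- A hypothesis introduced by `⊃R` is at once resolved by `goalL` into the instances that hold and
-- then disappears, so the recursion always resumes with an empty context.
derive : (B : Fm Γ) (Θ σ : Ctx) (s : Sub Γ (Θ ++ σ)) → Derivable Θ σ s B → Θ ⨾ [] ⊢ σ ▹ subF s B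
derive (A ∧ᶠ B) Θ σ s (p & q) = ∧R (derive A Θ σ s p) (derive B Θ σ s q)
derive (A ⊃ᶠ B) Θ σ s (w & p) = ⊃R (goalL A Θ σ s var s (λ x → ≡⇒≈ (sub-id var (λ _ → refl) (s x))) w λ {Θ'} r a →
  castʳ σ (subF-sub (liftS* σ r) s (liftS* σ r ∘ₛ s) (λ _ → refl) B) (derive B Θ' σ (liftS* σ r ∘ₛ s) (p r a)))
derive (∀ᶠ τ B) Θ σ s p = ∀R
  (castʳ σ (subF-sub (raiseSub σ) (liftS s) ((liftS* σ wkS ∘ₛ s) ▸ appAll σ v0) (raise-fresh σ s) B)
    (derive B (Θ , raise σ τ) σ ((liftS* σ wkS ∘ₛ s) ▸ appAll σ v0) (p wkS (appAll σ v0))))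
derive (∃ᶠ τ B) Θ σ s (t & p) = ∃R t
  (castʳ σ (subF-sub (sub0 t) (liftS s) (s ▸ t) (sub0-lift s t) B) (derive B Θ σ (s ▸ t) p))
derive (∇ᶠ τ B) Θ σ s p = ∇R (derive B Θ (σ , τ) (liftS s) p)
derive (atom A) Θ σ s p = p
derive ⊤ᶠ       Θ σ s p = p
derive ⊥ᶠ       Θ σ s p = p
derive (A ∨ᶠ B) Θ σ s p = p

-- From truth of bisimilarity at process terms to derivations

process-inst : (s : Sub Γ Δ) {M : Tm Γ (tn ⇒ tp)} {x : Tm Δ tn} → Process (↑ M · v0) → Process (sub s M · x)
process-inst s {M} {x} p = process-≈ (app≈ (≡⇒≈ (sub-↑ (s ▸ x) M)) ≈refl) (process-sub (s ▸ x) p)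

Processes : Atom Γ → Set
Processes (lbisim P Q) = Process P × Process Q
Processes (ebisim P Q) = Process P × Process Q
Processes _            = ⊥

-- Allows the transfer lemmas to serve both bisimilarities; for each, `Processes` computes to a
-- product and the proof is pairing.
Preserving : Rel → Set
Preserving R = ∀ {Γ} {P Q : Tm Γ tp} → Process P → Process Q → Processes (R P Q)

-- Recursion on `Bisim`, with derivations for the continuation atoms placed inside `Derivable`.
-- Process terms are what supplies the termination component for each antecedent.
bisim⇒⊢ : (Θ σ : Ctx) {A : Atom (Θ ++ σ)} → Bisim Θ σ A → Processes A → Θ ⨾ [] ⊢ σ ▹ atom A

FreeDerivable : Rel → (Θ σ : Ctx) → Tm (Θ ++ σ) tp → Tm (Θ ++ σ) ta → Tm (Θ ++ σ) tp → Set₁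
FreeDerivable R Θ σ Q A P' = Σ _ λ Q' → (Θ ⨾ [] ⊢ σ ▹ atom (one Q A Q')) × (Θ ⨾ [] ⊢ σ ▹ atom (R P' Q'))

LateDerivable OutDerivable :
  Rel → (Θ σ : Ctx) → Tm (Θ ++ σ) tp → Tm (Θ ++ σ) tn → Tm (Θ ++ σ) (tn ⇒ tp) → Set₁
LateDerivable R Θ σ Q X P' = Σ _ λ Q' → (Θ ⨾ [] ⊢ σ ▹ atom (onep Q (↓ X) Q')) ×
  (∀ {Θ'} (r : Sub Θ Θ') (w : Tm (Θ' ++ σ) tn) →
     Θ' ⨾ [] ⊢ σ ▹ atom (R (sub (liftS* σ r) P' · w) (sub (liftS* σ r) Q' · w)))
OutDerivable R Θ σ Q X P' = Σ _ λ Q' → (Θ ⨾ [] ⊢ σ ▹ atom (onep Q (↑ₐ X) Q')) ×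
  (Θ ⨾ [] ⊢ (σ , tn) ▹ atom (R (↑ P' · v0) (↑ Q' · v0)))

free⇒⊢ : (R : Rel) → Preserving R → (Θ σ : Ctx) {P Q P' : Tm (Θ ++ σ) tp} {A : Tm (Θ ++ σ) ta} →
         Process P → Process Q → Holds (one P A P') → FreeMatch R Θ σ Q A P' → FreeDerivable R Θ σ Q A P'
free⇒⊢ R join Θ σ p q h (Q' & h' & b) =
  Q' & holds⇒⊢ Θ σ h' & bisim⇒⊢ Θ σ b (join (one-process h p) (one-process h' q))

late⇒⊢ : (R : Rel) → Preserving R → (Θ σ : Ctx) {P Q : Tm (Θ ++ σ) tp} {X : Tm (Θ ++ σ) tn} (P' : Tm (Θ ++ σ) (tn ⇒ tp)) →
         Process P → Process Q → Holds (onep P (↓ X) P') → LateMatch R Θ σ Q X P' → LateDerivable R Θ σ Q X P'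
late⇒⊢ R join Θ σ P' p q h (Q' & h' & b) = Q' & holds⇒⊢ Θ σ h' & λ {Θ'} r w → bisim⇒⊢ Θ' σ (b r w)
  (join (process-inst (liftS* σ r) (onep-process h p)) (process-inst (liftS* σ r) (onep-process h' q)))

early⇒⊢ : (R : Rel) → Preserving R → (Θ σ : Ctx) {Θ' : Ctx} (r : Sub Θ Θ') (w : Tm (Θ' ++ σ) tn)
          {P Q : Tm (Θ ++ σ) tp} {X : Tm (Θ ++ σ) tn} (P' : Tm (Θ ++ σ) (tn ⇒ tp)) →
          Process P → Process Q → Holds (onep P (↓ X) P') →
          (Σ _ λ Q' → Holds (onep (sub (liftS* σ r) Q) (↓ (sub (liftS* σ r) X)) Q') ×
             Bisim Θ' σ (R (sub (liftS* σ r) P' · w) (Q' · w))) →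
          Σ _ λ Q' → (Θ' ⨾ [] ⊢ σ ▹ atom (onep (sub (liftS* σ r) Q) (↓ (sub (liftS* σ r) X)) Q')) ×
             (Θ' ⨾ [] ⊢ σ ▹ atom (R (sub (liftS* σ r) P' · w) (Q' · w)))
early⇒⊢ R join Θ σ {Θ'} r w P' p q h (Q' & h' & b) = Q' & holds⇒⊢ Θ' σ h' & bisim⇒⊢ Θ' σ b
  (join (process-inst (liftS* σ r) (onep-process h p))
        (process-app (onep-process h' (process-sub (liftS* σ r) q))))

out⇒⊢ : (R : Rel) → Preserving R → (Θ σ : Ctx) {P Q : Tm (Θ ++ σ) tp} {X : Tm (Θ ++ σ) tn} {P' : Tm (Θ ++ σ) (tn ⇒ tp)} →
        Process P → Process Q → Holds (onep P (↑ₐ X) P') → OutMatch R Θ σ Q X P' → OutDerivable R Θ σ Q X P'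
out⇒⊢ R join Θ σ p q h (Q' & h' & b) =
  Q' & holds⇒⊢ Θ σ h' & bisim⇒⊢ Θ (σ , tn) b (join (onep-process h p) (onep-process h' q))

bisim⇒⊢ Θ σ (unfoldˡ θ e@(lbisim≈ eP eQ) ((f & i & o) & (f' & i' & o'))) (pP & pQ) =
  defR _ c-lbisim θ e (derive (lbisimBody v1 v0) Θ σ θ
    ((free x₁ x₀ p q f & input x₁ x₀ p q i & output x₁ x₀ p q o) &
     (free x₀ x₁ q p f' & input x₀ x₁ q p i' & output x₀ x₁ q p o')))
  where
  p : Process (θ x₁)
  p = process-≈ eP pP
  q : Process (θ x₀)
  q = process-≈ eQ pQ
  later : ∀ {Θ' Θ''} (r : Sub Θ Θ') (r' : Sub Θ' Θ'') {t} → Process t → Process (sub (liftS* σ r') (sub (liftS* σ r) t))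
  later r r' p = process-sub (liftS* σ r') (process-sub (liftS* σ r) p)
  later² : ∀ {Θ' Θ'' Θ₃} (r : Sub Θ Θ') (r' : Sub Θ' Θ'') (r'' : Sub Θ'' Θ₃) {t} → Process t →
           Process (sub (liftS* σ r'') (sub (liftS* σ r') (sub (liftS* σ r) t)))
  later² r r' r'' p = process-sub (liftS* σ r'') (later r r' p)
  free : (x y : ε , tp , tp ∋ tp) → Process (θ x) → Process (θ y) →
         Forces⁺ Bisim Θ σ θ (freeC lbisim (var x) (var y)) → Derivable Θ σ θ (freeC lbisim (var x) (var y))
  free x y p q f {Θ'} r A {Θ''} r' P' =
    -- The first component bounds the unfolding of the hypothesis on an instance of `P`; the second
    -- turns each instance that holds into an answer by forcing.
    proj₁ (wf-here (process-wf (later r r' p))) _ _ & λ {Θ₃} r'' h →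
    free⇒⊢ lbisim _&_ Θ₃ σ (later² r r' r'' p) (later² r r' r'' q) h (f r A r' P' r'' h)
  input : (x y : ε , tp , tp ∋ tp) → Process (θ x) → Process (θ y) →
          Forces⁺ Bisim Θ σ θ (lInC lbisim (var x) (var y)) → Derivable Θ σ θ (lInC lbisim (var x) (var y))
  input x y p q f {Θ'} r X {Θ''} r' P' =
    proj₂ (wf-here (process-wf (later r r' p))) _ _ & λ {Θ₃} r'' h →
    late⇒⊢ lbisim _&_ Θ₃ σ (sub (liftS* σ r'') P') (later² r r' r'' p) (later² r r' r'' q) h (f r X r' P' r'' h)
  output : (x y : ε , tp , tp ∋ tp) → Process (θ x) → Process (θ y) →
           Forces⁺ Bisim Θ σ θ (outConj lbisim (var x) (var y)) → Derivable Θ σ θ (outConj lbisim (var x) (var y))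
  output x y p q f {Θ'} r X {Θ''} r' P' =
    proj₂ (wf-here (process-wf (later r r' p))) _ _ & λ {Θ₃} r'' h →
    out⇒⊢ lbisim _&_ Θ₃ σ (later² r r' r'' p) (later² r r' r'' q) h (f r X r' P' r'' h)
bisim⇒⊢ Θ σ (unfoldᵉ θ e@(ebisim≈ eP eQ) ((f & i & o) & (f' & i' & o'))) (pP & pQ) =
  defR _ c-ebisim θ e (derive (ebisimBody v1 v0) Θ σ θ
    ((free x₁ x₀ p q f & input x₁ x₀ p q i & output x₁ x₀ p q o) &
     (free x₀ x₁ q p f' & input x₀ x₁ q p i' & output x₀ x₁ q p o')))
  where
  p : Process (θ x₁)
  p = process-≈ eP pP
  q : Process (θ x₀)
  q = process-≈ eQ pQ
  later : ∀ {Θ' Θ''} (r : Sub Θ Θ') (r' : Sub Θ' Θ'') {t} → Process t → Process (sub (liftS* σ r') (sub (liftS* σ r) t))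
  later r r' p = process-sub (liftS* σ r') (process-sub (liftS* σ r) p)
  later² : ∀ {Θ' Θ'' Θ₃} (r : Sub Θ Θ') (r' : Sub Θ' Θ'') (r'' : Sub Θ'' Θ₃) {t} → Process t →
           Process (sub (liftS* σ r'') (sub (liftS* σ r') (sub (liftS* σ r) t)))
  later² r r' r'' p = process-sub (liftS* σ r'') (later r r' p)
  free : (x y : ε , tp , tp ∋ tp) → Process (θ x) → Process (θ y) →
         Forces⁺ Bisim Θ σ θ (freeC ebisim (var x) (var y)) → Derivable Θ σ θ (freeC ebisim (var x) (var y))
  free x y p q f {Θ'} r A {Θ''} r' P' =
    proj₁ (wf-here (process-wf (later r r' p))) _ _ & λ {Θ₃} r'' h →
    free⇒⊢ ebisim _&_ Θ₃ σ (later² r r' r'' p) (later² r r' r'' q) h (f r A r' P' r'' h)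
  input : (x y : ε , tp , tp ∋ tp) → Process (θ x) → Process (θ y) →
          Forces⁺ Bisim Θ σ θ (eInC ebisim (var x) (var y)) → Derivable Θ σ θ (eInC ebisim (var x) (var y))
  input x y p q f {Θ'} r X {Θ''} r' P' =
    proj₂ (wf-here (process-wf (later r r' p))) _ _ & λ {Θ₃} r'' h →
    λ r₃ w → early⇒⊢ ebisim _&_ Θ₃ σ r₃ w (sub (liftS* σ r'') P') (later² r r' r'' p) (later² r r' r'' q) h (f r X r' P' r'' h r₃ w)
  output : (x y : ε , tp , tp ∋ tp) → Process (θ x) → Process (θ y) →
           Forces⁺ Bisim Θ σ θ (outConj ebisim (var x) (var y)) → Derivable Θ σ θ (outConj ebisim (var x) (var y))
  output x y p q f {Θ'} r X {Θ''} r' P' =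
    proj₂ (wf-here (process-wf (later r r' p))) _ _ & λ {Θ₃} r'' h →
    out⇒⊢ ebisim _&_ Θ₃ σ (later² r r' r'' p) (later² r r' r'' q) h (f r X r' P' r'' h)

-- Closed statements and their free names

forces-names : (k : ℕ) (B : Fm (nctx k)) → Forces ε ε var (∀names k B) → Forces (nctx k) ε var B
forces-names zero    B p = p
-- Instantiating at `v0` after `wkS` gives the identity environment, so each quantified name is read
-- as its own eigenvariable.
forces-names (suc k) B p = forces-≈ B (nctx k , tn) ε ((wkS ∘ₛ var) ▸ v0) var
  (λ { here → ≈refl ; (there x) → ≈refl }) (forces-names k (∀ᶠ tn B) p wkS v0)

provable⇒forces : (k : ℕ) (B : Fm (nctx k)) → Provable (∀names k B) → Forces (nctx k) ε var B
provable⇒forces k B d = forces-names k B (soundness d var [])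

generalize : (k : ℕ) (B : Fm (nctx k)) → nctx k ⨾ [] ⊢ ε ▹ B → Provable (∀names k B)
generalize zero    B d = d
-- Over the empty local signature raising is trivial, so `raiseSub ε` acts as the identity.
generalize (suc k) B d = generalize k (∀ᶠ tn B)
  (∀R (castʳ ε (subF-id (raiseSub ε) (λ { here → refl ; (there x) → refl }) B) d))

theorem5p13 : (k : ℕ) (P Q : Proc k) →
    ((i : Fin k) → i freeIn P ⊎ i freeIn Q) →
    Provable (∀names k (atom (lbisim ⟦ P ⟧ ⟦ Q ⟧))) ⇔
    Provable (∀names k (atom (ebisim ⟦ P ⟧ ⟦ Q ⟧)))
theorem5p13 k P Q _ = mk⇔
  (λ d → generalize k _ (bisim⇒⊢ (nctx k) ε
    (lbisim⇒ebisim (nctx k) ε (at-names (lbisim ⟦ P ⟧ ⟦ Q ⟧) (provable⇒forces k (atom (lbisim ⟦ P ⟧ ⟦ Q ⟧)) d))) processes))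
  (λ d → generalize k _ (bisim⇒⊢ (nctx k) ε
    (ebisim⇒lbisim (nctx k) ε (at-names (ebisim ⟦ P ⟧ ⟦ Q ⟧) (provable⇒forces k (atom (ebisim ⟦ P ⟧ ⟦ Q ⟧)) d))) processes))
  where
  processes : Process ⟦ P ⟧ × Process ⟦ Q ⟧
  processes = ⟦⟧-process P & ⟦⟧-process Q
  at-names : (A : Atom (nctx k)) → Bisim (nctx k) ε (subA var A) → Bisim (nctx k) ε A
  at-names A = bisim-≈ {Θ = nctx k} {ε} (≡⇒≈A (subA-id A))
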